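{- Let $Z_n$ be the number of zeros of a random lattice path $P_n$ of length $n$ (chosen according to the model in the context). Then, as $n\to\infty$, $$\mathbb{E}(Z_n)=\frac12\log n+\frac{\gamma+\log2}{2}+\frac{1+[n\text{ even}]}{2n}-\frac{2+9[n\text{ even}]}{12n^2}+\frac{[n\text{ even}]}{n^3}+O\Bigl(\frac1{n^4}\Bigr).$$
   Context: $[\mathit{expr}]$ is $1$ if $\mathit{expr}$ is true and $0$ otherwise; $\log$ is the natural logarithm; $\gamma$ is the Euler--Mascheroni constant. Random path model: for an integer $n\ge0$, a random path $P_n$ on the lattice $\mathbb{Z}^2$ with steps $(1,+1)$ and $(1,-1)$, ending in $(n,0)$, is chosen as follows. First choose a starting point $(0,S)$ with $S$ uniformly distributed in $\{ -n,-n+2,\dots,n-2,n\}$. Then choose a path uniformly at random among all paths from $(0,S)$ to $(n,0)$. A zero of $P_n$ is a lattice point $(x,0)\in P_n$ visited by the path (including the starting point if $S=0$ and the end point $(n,0)$). -}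

module Defs where

open import Data.Integer.Base as ℤ using (ℤ; +_; 0ℤ)
import Data.Integer.Properties as ℤ
open import Data.List.Base using (List; []; _∷_; _++_; map; filter; concatMap; foldr; length; upTo)
open import Data.Nat.Base as ℕ using (ℕ; zero; suc; z≤n; s≤s)
import Data.Nat.Divisibility as ℕ
import Data.Nat.Properties as ℕ
import Data.Nat.Tactic.RingSolver as ℕ-Tactic
open import Data.Product.Base using (_×_; _,_; proj₁; proj₂; ∃-syntax)
open import Data.Rational.Base as ℚ
  using (ℚ; mkℚ; 0ℚ; 1ℚ; ½; _+_; _*_; _-_; -_; ∣_∣; _≤_; _<_; _/_; fromℚᵘ; toℚᵘ)
import Data.Rational.Properties as ℚ
open import Data.Rational.Solver using (module +-*-Solver)
open import Data.Rational.Unnormalised.Base as ℚᵘ using (ℚᵘ; mkℚᵘ)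
import Data.Rational.Unnormalised.Properties as ℚᵘ
open import Data.Sum.Base using (inj₁; inj₂)
open import Data.Vec.Base using (Vec; []; _∷_; count)
open import Relation.Binary.PropositionalEquality
  using (_≡_; refl; sym; trans; cong; cong₂; subst; subst₂)
open import Relation.Nullary.Decidable using (Dec; yes; no)

Σ< : ℕ → (ℕ → ℚ) → ℚ
Σ< zero    f = 0ℚ
Σ< (suc n) f = Σ< n f + f n

syntax Σ< n (λ i → e) = Σ[ i < n ] e

harmonic : ℕ → ℚ
harmonic n = Σ[ i < n ] (+ 1 / suc i)

infix 8 1/_^_

-- 1/ n ^ k is 1 / nᵏ.
1/_^_ : (n k : ℕ) .{{_ : ℕ.NonZero n}} → ℚ
1/ n ^ k = (+ 1 / n ℕ.^ k) {{ℕ.m^n≢0 n k}}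

[_] : ∀ {p} {P : Set p} → Dec P → ℕ
[ yes _ ] = 1
[ no  _ ] = 0

even? : (n : ℕ) → Dec (2 ℕ.∣ n)
even? n = 2 ℕ.∣? n

-- A finitely supported distribution, as a list of weighted outcomes.
Dist : Set → Set
Dist A = List (ℚ × A)

-- The value at [] is junk: below, `uniform` is only applied to nonempty
-- lists without repetitions.
uniform : {A : Set} → List A → Dist A
uniform []         = []
uniform xs@(_ ∷ _) = map (λ x → (+ 1 / length xs) , x) xs

_>>=_ : {A B : Set} → Dist A → (A → Dist B) → Dist B
d >>= f = concatMap (λ (p , x) → map (λ (q , y) → p * q , y) (f x)) d

𝔼 : {A : Set} → Dist A → (A → ℚ) → ℚ
𝔼 d X = foldr (λ (p , x) r → p * X x + r) 0ℚ d

data Step : Set where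
  up down : Step

move : Step → ℤ → ℤ
move up   y = y ℤ.+ ℤ.1ℤ
move down y = y ℤ.- ℤ.1ℤ

-- A path of length n is its starting height together with its steps; it
-- visits the points (0 , y₀), …, (n , yₙ).
Path : ℕ → Set
Path n = ℤ × Vec Step n

heights : ∀ {n} → Path n → Vec ℤ (suc n)
heights (y , [])     = y ∷ []
heights (y , s ∷ ss) = y ∷ heights (move s y , ss)

endHeight : ∀ {n} → Path n → ℤ
endHeight (y , [])     = y
endHeight (y , s ∷ ss) = endHeight (move s y , ss)

stepSequences : (n : ℕ) → List (Vec Step n)
stepSequences zero    = [] ∷ []
stepSequences (suc n) = map (up ∷_) (stepSequences n) ++ map (down ∷_) (stepSequences n)

-- All paths from (0 , S) to (n , 0).
pathsFrom : (n : ℕ) → ℤ → List (Path n)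
pathsFrom n S = filter (λ P → endHeight P ℤ.≟ 0ℤ) (map (S ,_) (stepSequences n))

-- -n , -n + 2 , … , n - 2 , n
startingHeights : ℕ → List ℤ
startingHeights n = map (λ j → + (2 ℕ.* j) ℤ.- + n) (upTo (suc n))

randomPath : (n : ℕ) → Dist (Path n)
randomPath n = uniform (startingHeights n) >>= λ S → uniform (pathsFrom n S)

zeros : ∀ {n} → Path n → ℕ
zeros P = count (ℤ._≟ 0ℤ) (heights P)

𝔼Z : ℕ → ℚ
𝔼Z n = 𝔼 (randomPath n) (λ P → + zeros P / 1)

module Aux where
  open +-*-Solver

  tri : ∀ a b c → ∣ a - c ∣ ≤ ∣ a - b ∣ + ∣ b - c ∣
  tri a b c = subst (λ z → ∣ z ∣ ≤ ∣ a - b ∣ + ∣ b - c ∣)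
    (solve 3 (λ a b c → (a :- b) :+ (b :- c) := a :- c) refl a b c)
    (ℚ.∣p+q∣≤∣p∣+∣q∣ (a - b) (b - c))

  dist-sym : ∀ a b → ∣ a - b ∣ ≡ ∣ b - a ∣
  dist-sym a b = trans (sym (ℚ.∣-p∣≡∣p∣ (a - b)))
    (cong ∣_∣ (solve 2 (λ a b → :- (a :- b) := b :- a) refl a b))

  a-a : ∀ a → ∣ a - a ∣ ≡ 0ℚ
  a-a a = cong ∣_∣ (ℚ.+-inverseʳ a)

  halves : ∀ ε → ½ * ε + ½ * ε ≡ ε
  halves ε = trans (sym (ℚ.*-distribʳ-+ ε ½ ½)) (ℚ.*-identityˡ ε)

  half-pos : ∀ {ε} → 0ℚ < ε → 0ℚ < ½ * ε
  half-pos {ε} p = subst (_< ½ * ε) (ℚ.*-zeroʳ ½) (ℚ.*-monoʳ-<-pos ½ p)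

  ≤-sub : ∀ {a b} → a ≤ b → 0ℚ ≤ b - a
  ≤-sub {a} {b} p = subst (_≤ b - a) (ℚ.+-inverseʳ a) (ℚ.+-monoˡ-≤ (- a) p)

  sub-≤ : ∀ {a b} → 0ℚ ≤ b - a → a ≤ b
  sub-≤ {a} {b} p = subst₂ _≤_ (ℚ.+-identityˡ a)
    (solve 2 (λ a b → (b :- a) :+ a := b) refl a b) (ℚ.+-monoˡ-≤ a p)

  p≤∣p∣ : ∀ p → p ≤ ∣ p ∣
  p≤∣p∣ p with ℚ.≤-total 0ℚ p
  ... | inj₁ 0≤p = ℚ.≤-reflexive (sym (ℚ.0≤p⇒∣p∣≡p 0≤p))
  ... | inj₂ p≤0 = ℚ.≤-trans p≤0 (ℚ.0≤∣p∣ p)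

  ∣∣-≤ : ∀ {p c} → p ≤ c → - p ≤ c → ∣ p ∣ ≤ c
  ∣∣-≤ {p} {c} u v with ℚ.∣p∣≡p∨∣p∣≡-p p
  ... | inj₁ e = subst (_≤ c) (sym e) u
  ... | inj₂ e = subst (_≤ c) (sym e) v

  ∣∣-lip : ∀ a b → ∣ ∣ a ∣ - ∣ b ∣ ∣ ≤ ∣ a - b ∣
  ∣∣-lip a b = ∣∣-≤ (one a b)
    (subst₂ _≤_ (solve 2 (λ x y → y :- x := :- (x :- y)) refl (∣ a ∣) (∣ b ∣))
                (dist-sym b a) (one b a))
    where
    one : ∀ a b → ∣ a ∣ - ∣ b ∣ ≤ ∣ a - b ∣
    one a b = sub-≤ (subst (0ℚ ≤_)
      (solve 3 (λ x y z → (z :+ y) :- x := z :- (x :- y)) refl (∣ a ∣) (∣ b ∣) (∣ a - b ∣))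
      (≤-sub (subst (λ z → ∣ z ∣ ≤ ∣ a - b ∣ + ∣ b ∣)
        (solve 2 (λ a b → (a :- b) :+ b := a) refl a b)
        (ℚ.∣p+q∣≤∣p∣+∣q∣ (a - b) b))))

  fromℚᵘ-homo-* : ∀ p q → fromℚᵘ p * fromℚᵘ q ≡ fromℚᵘ (p ℚᵘ.* q)
  fromℚᵘ-homo-* p q = ℚ.toℚᵘ-injective
    (ℚᵘ.≃-trans (ℚ.toℚᵘ-homo-* (fromℚᵘ p) (fromℚᵘ q))
    (ℚᵘ.≃-trans (ℚᵘ.*-cong (ℚ.toℚᵘ-fromℚᵘ p) (ℚ.toℚᵘ-fromℚᵘ q))
                (ℚᵘ.≃-sym (ℚ.toℚᵘ-fromℚᵘ (p ℚᵘ.* q)))))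

  fromℚᵘ-homo-+ : ∀ p q → fromℚᵘ p + fromℚᵘ q ≡ fromℚᵘ (p ℚᵘ.+ q)
  fromℚᵘ-homo-+ p q = ℚ.toℚᵘ-injective
    (ℚᵘ.≃-trans (ℚ.toℚᵘ-homo-+ (fromℚᵘ p) (fromℚᵘ q))
    (ℚᵘ.≃-trans (ℚᵘ.+-cong (ℚ.toℚᵘ-fromℚᵘ p) (ℚ.toℚᵘ-fromℚᵘ q))
                (ℚᵘ.≃-sym (ℚ.toℚᵘ-fromℚᵘ (p ℚᵘ.+ q)))))

  fromℚᵘ-mono : ∀ {p q} → p ℚᵘ.≤ q → fromℚᵘ p ≤ fromℚᵘ q
  fromℚᵘ-mono {p} {q} p≤q = ℚ.toℚᵘ-cancel-≤
    (ℚᵘ.≤-respʳ-≃ (ℚᵘ.≃-sym (ℚ.toℚᵘ-fromℚᵘ q))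
    (ℚᵘ.≤-respˡ-≃ (ℚᵘ.≃-sym (ℚ.toℚᵘ-fromℚᵘ p)) p≤q))

  inv : ℕ → ℚ
  inv zero    = 0ℚ
  inv (suc k) = + 1 / suc k

  inv-pos : ∀ k → 0ℚ < inv (suc k)
  inv-pos k = ℚ.positive⁻¹ _ {{ℚ.normalize-pos 1 (suc k)}}

  inv-nonNeg : ∀ k → 0ℚ ≤ inv k
  inv-nonNeg zero    = ℚ.≤-refl
  inv-nonNeg (suc k) = ℚ.<⇒≤ (inv-pos k)

  inv-anti : ∀ a b → a ℕ.≤ b → inv (suc b) ≤ inv (suc a)
  inv-anti a b a≤b = fromℚᵘ-mono {mkℚᵘ (+ 1) b} {mkℚᵘ (+ 1) a}
    (ℚᵘ.*≤* (subst₂ ℤ._≤_ (sym (ℤ.*-identityˡ (+ suc a))) (sym (ℤ.*-identityˡ (+ suc b)))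
      (ℤ.+≤+ (s≤s a≤b))))

  ι : ℕ → ℚ
  ι m = + m / 1

  ι-suc : ∀ m → ι (suc m) ≡ ι m + 1ℚ
  ι-suc m = sym (trans (fromℚᵘ-homo-+ (mkℚᵘ (+ m) 0) (mkℚᵘ (+ 1) 0))
    (ℚ.fromℚᵘ-cong {mkℚᵘ (+ m) 0 ℚᵘ.+ mkℚᵘ (+ 1) 0} {mkℚᵘ (+ suc m) 0}
      (ℚᵘ.*≡* (cong (ℤ._* (+ 1))
        (trans (cong (ℤ._+ (+ 1)) (ℤ.*-identityʳ (+ m))) (cong +_ (ℕ.+-comm m 1)))))))

  ι*inv : ∀ a m → ι (suc m) * inv (suc a ℕ.* suc m) ≡ inv (suc a)
  ι*inv a m = trans (fromℚᵘ-homo-* (mkℚᵘ (+ suc m) 0) p)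
    (ℚ.fromℚᵘ-cong {mkℚᵘ (+ suc m) 0 ℚᵘ.* p} {mkℚᵘ (+ 1) a} (ℚᵘ.*≡* (cong +_ (lem (suc a) (suc m)))))
    where
    p = mkℚᵘ (+ 1) (m ℕ.+ a ℕ.* suc m)
    lem : ∀ a m → (m ℕ.* 1) ℕ.* a ≡ 1 ℕ.* (1 ℕ.* (a ℕ.* m))
    lem = ℕ-Tactic.solve-∀

  archimedean : ∀ ε → 0ℚ < ε → ∃[ N ] ∀ n → N ℕ.≤ n → inv (suc n) ≤ ε
  archimedean (mkℚ (+ suc p) d c) 0<ε = d , λ n d≤n → ℚ.≤-trans (inv-anti d n d≤n)
    (ℚ.toℚᵘ-cancel-≤ (ℚᵘ.≤-respˡ-≃ (ℚᵘ.≃-sym (ℚ.toℚᵘ-fromℚᵘ (mkℚᵘ (+ 1) d)))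
      (ℚᵘ.*≤* (ℤ.*-monoʳ-≤-nonNeg (+ suc d) {+ 1} {+ suc p} (ℤ.+≤+ (s≤s z≤n))))))
  archimedean (mkℚ (+ zero) d c) (ℚ.*<* (ℤ.+<+ ()))
  archimedean (mkℚ (ℤ.-[1+ p ]) d c) (ℚ.*<* ())

  Σ-mono : ∀ n {f g : ℕ → ℚ} → (∀ i → i ℕ.< n → f i ≤ g i) → Σ< n f ≤ Σ< n g
  Σ-mono zero    p = ℚ.≤-refl
  Σ-mono (suc n) p = ℚ.+-mono-≤ (Σ-mono n (λ i i<n → p i (ℕ.m<n⇒m<1+n i<n))) (p n ℕ.≤-refl)

  Σ-cong : ∀ n {f g : ℕ → ℚ} → (∀ i → f i ≡ g i) → Σ< n f ≡ Σ< n g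
  Σ-cong zero    p = refl
  Σ-cong (suc n) p = cong₂ _+_ (Σ-cong n p) (p n)

  Σ-const : ∀ n c → Σ< n (λ _ → c) ≡ ι n * c
  Σ-const zero    c = sym (ℚ.*-zeroˡ c)
  Σ-const (suc n) c = trans (cong (_+ c) (Σ-const n c))
    (trans (solve 2 (λ x c → x :* c :+ c := (x :+ con 1ℚ) :* c) refl (ι n) c)
           (cong (_* c) (sym (ι-suc n))))

  Σ-split : ∀ m n f → Σ< (m ℕ.+ n) f ≡ Σ< m f + Σ< n (λ i → f (m ℕ.+ i))
  Σ-split m zero    f = trans (cong (λ z → Σ< z f) (ℕ.+-identityʳ m)) (sym (ℚ.+-identityʳ _))
  Σ-split m (suc n) f = trans (cong (λ z → Σ< z f) (ℕ.+-suc m n))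
    (trans (cong (_+ f (m ℕ.+ n)) (Σ-split m n f)) (ℚ.+-assoc (Σ< m f) (Σ< n (λ i → f (m ℕ.+ i))) (f (m ℕ.+ n))))

  -- h a ℓ = 1/a + 1/(a+1) + … + 1/(a+ℓ-1)
  h : ℕ → ℕ → ℚ
  h a ℓ = Σ[ i < ℓ ] inv (a ℕ.+ i)

  h-split : ∀ a m n → h a (m ℕ.+ n) ≡ h a m + h (a ℕ.+ m) n
  h-split a m n = trans (Σ-split m n _)
    (cong (_+_ (h a m)) (Σ-cong n (λ i → cong inv (sym (ℕ.+-assoc a m i)))))

  h-shift : ∀ a ℓ → h (suc a) ℓ - h (suc (suc a)) ℓ ≡ inv (suc a) - inv (suc a ℕ.+ ℓ)
  h-shift a zero = trans (solve 0 (con 0ℚ :- con 0ℚ := con 0ℚ) refl)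
    (sym (trans (cong (λ z → inv (suc a) - inv (suc z)) (ℕ.+-identityʳ a))
                (ℚ.+-inverseʳ (inv (suc a)))))
  h-shift a (suc ℓ) = trans
    (solve 4 (λ x y p q → (x :+ p) :- (y :+ q) := (x :- y) :+ (p :- q)) refl
       (h (suc a) ℓ) (h (suc (suc a)) ℓ) (inv (suc a ℕ.+ ℓ)) (inv (suc (suc a) ℕ.+ ℓ)))
    (trans (cong (_+ (inv (suc a ℕ.+ ℓ) - inv (suc (suc a) ℕ.+ ℓ))) (h-shift a ℓ))
    (trans (solve 3 (λ x p q → (x :- p) :+ (p :- q) := x :- q) refl
       (inv (suc a)) (inv (suc a ℕ.+ ℓ)) (inv (suc (suc a) ℕ.+ ℓ)))
       (cong (λ z → inv (suc a) - inv (suc z)) (sym (ℕ.+-suc a ℓ)))))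

  block-upper : ∀ a m → h (suc a ℕ.* suc m) (suc m) ≤ inv (suc a)
  block-upper a m = subst (h (suc a ℕ.* suc m) (suc m) ≤_)
    (trans (Σ-const (suc m) _) (ι*inv a m))
    (Σ-mono (suc m) (λ i _ → inv-anti (m ℕ.+ a ℕ.* suc m) (m ℕ.+ a ℕ.* suc m ℕ.+ i) (ℕ.m≤m+n _ i)))

  block-lower : ∀ a m → inv (suc (suc a)) ≤ h (suc a ℕ.* suc m) (suc m)
  block-lower a m = subst (_≤ h (suc a ℕ.* suc m) (suc m))
    (trans (Σ-const (suc m) _) (ι*inv (suc a) m))
    (Σ-mono (suc m) (λ i i<m → inv-anti (m ℕ.+ a ℕ.* suc m ℕ.+ i) (m ℕ.+ suc a ℕ.* suc m)
      (subst (m ℕ.+ a ℕ.* suc m ℕ.+ i ℕ.≤_)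
             (trans (ℕ.+-comm (m ℕ.+ a ℕ.* suc m) (suc m)) (sym (ℕ.+-suc m _)))
             (ℕ.+-monoʳ-≤ (m ℕ.+ a ℕ.* suc m) (ℕ.<⇒≤ i<m)))))

  next-block : ∀ a ℓ m → h (a ℕ.* m) (suc ℓ ℕ.* m) ≡ h (a ℕ.* m) (ℓ ℕ.* m) + h ((a ℕ.+ ℓ) ℕ.* m) m
  next-block a ℓ m = trans (cong (h (a ℕ.* m)) (ℕ.+-comm m (ℓ ℕ.* m)))
    (trans (h-split (a ℕ.* m) (ℓ ℕ.* m) m)
           (cong (λ z → h (a ℕ.* m) (ℓ ℕ.* m) + h z m) (sym (ℕ.*-distribʳ-+ m a ℓ))))

  refine-upper : ∀ a ℓ m → h (suc a ℕ.* suc m) (ℓ ℕ.* suc m) ≤ h (suc a) ℓ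
  refine-upper a zero    m = ℚ.≤-refl
  refine-upper a (suc ℓ) m = subst (_≤ h (suc a) (suc ℓ)) (sym (next-block (suc a) ℓ (suc m)))
    (ℚ.+-mono-≤ (refine-upper a ℓ m) (block-upper (a ℕ.+ ℓ) m))

  refine-lower : ∀ a ℓ m → h (suc (suc a)) ℓ ≤ h (suc a ℕ.* suc m) (ℓ ℕ.* suc m)
  refine-lower a zero    m = ℚ.≤-refl
  refine-lower a (suc ℓ) m = subst (h (suc (suc a)) (suc ℓ) ≤_) (sym (next-block (suc a) ℓ (suc m)))
    (ℚ.+-mono-≤ (refine-lower a ℓ m) (block-lower (a ℕ.+ ℓ) m))

  h-shift-≤ : ∀ a ℓ → h (suc a) ℓ - h (suc (suc a)) ℓ ≤ inv (suc a)
  h-shift-≤ a ℓ = sub-≤ (subst (0ℚ ≤_)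
    (trans (solve 2 (λ x y → y := x :- (x :- y)) refl (inv (suc a)) (inv (suc a ℕ.+ ℓ)))
           (cong (_-_ (inv (suc a))) (sym (h-shift a ℓ))))
    (inv-nonNeg (suc a ℕ.+ ℓ)))

  sandwich : ∀ {lo x y hi d} → lo ≤ x → x ≤ hi → lo ≤ y → y ≤ hi → hi - lo ≤ d → ∣ x - y ∣ ≤ d
  sandwich {lo} {x} {y} {hi} {d} a b c e f = ∣∣-≤
    (ℚ.≤-trans (ℚ.+-mono-≤ b (ℚ.neg-antimono-≤ c)) f)
    (subst (_≤ d) (solve 2 (λ x y → y :- x := :- (x :- y)) refl x y)
      (ℚ.≤-trans (ℚ.+-mono-≤ e (ℚ.neg-antimono-≤ a)) f))

  h-anti : ∀ a ℓ → h (suc (suc a)) ℓ ≤ h (suc a) ℓ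
  h-anti a ℓ = Σ-mono ℓ (λ i _ → inv-anti (a ℕ.+ i) (suc a ℕ.+ i) (ℕ.n≤1+n (a ℕ.+ i)))

  refine-dist : ∀ a ℓ m → ∣ h (suc a) ℓ - h (suc a ℕ.* suc m) (ℓ ℕ.* suc m) ∣ ≤ inv (suc a)
  refine-dist a ℓ m = sandwich (h-anti a ℓ) ℚ.≤-refl (refine-lower a ℓ m) (refine-upper a ℓ m)
    (h-shift-≤ a ℓ)

  refine-dist′ : ∀ a ℓ m → ∣ h (suc (suc a)) ℓ - h (suc a ℕ.* suc m) (ℓ ℕ.* suc m) ∣ ≤ inv (suc a)
  refine-dist′ a ℓ m = sandwich ℚ.≤-refl (h-anti a ℓ) (refine-lower a ℓ m) (refine-upper a ℓ m)
    (h-shift-≤ a ℓ)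

open Aux

IsCauchy : (ℕ → ℚ) → Set
IsCauchy s = ∀ ε → 0ℚ < ε → ∃[ N ] ∀ m n → N ℕ.≤ m → N ℕ.≤ n → ∣ s m - s n ∣ ≤ ε

-- Equality is not quotiented: two reals are equal when each is ≤ᴿ the other.
record ℝ : Set where
  constructor mkℝ
  field
    seq    : ℕ → ℚ
    cauchy : IsCauchy seq

open ℝ public

fromℚ : ℚ → ℝ
fromℚ q = mkℝ (λ _ → q) λ ε 0<ε → 0 , λ _ _ _ _ →
  subst (_≤ ε) (sym (a-a q)) (ℚ.<⇒≤ 0<ε)

infixl 6 _+ᴿ_ _-ᴿ_
infixl 7 _·_
infix  4 _≤ᴿ_

_+ᴿ_ : ℝ → ℝ → ℝ
x +ᴿ y = mkℝ (λ k → seq x k + seq y k) λ ε 0<ε →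
  let (N₁ , p₁) = cauchy x (½ * ε) (half-pos 0<ε)
      (N₂ , p₂) = cauchy y (½ * ε) (half-pos 0<ε)
  in N₁ ℕ.⊔ N₂ , λ m n N≤m N≤n →
    subst (∣ (seq x m + seq y m) - (seq x n + seq y n) ∣ ≤_) (halves ε)
      (ℚ.≤-trans
        (subst (λ z → ∣ z ∣ ≤ ∣ seq x m - seq x n ∣ + ∣ seq y m - seq y n ∣)
          (+-*-Solver.solve 4 (λ a b c d → (a :- b) :+ (c :- d) := (a :+ c) :- (b :+ d)) refl
            (seq x m) (seq x n) (seq y m) (seq y n))
          (ℚ.∣p+q∣≤∣p∣+∣q∣ (seq x m - seq x n) (seq y m - seq y n)))
        (ℚ.+-mono-≤
          (p₁ m n (ℕ.m⊔n≤o⇒m≤o N₁ N₂ N≤m) (ℕ.m⊔n≤o⇒m≤o N₁ N₂ N≤n))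
          (p₂ m n (ℕ.m⊔n≤o⇒n≤o N₁ N₂ N≤m) (ℕ.m⊔n≤o⇒n≤o N₁ N₂ N≤n))))
  where open +-*-Solver using (_:+_; _:-_; _:=_)

_·_ : ℚ → ℝ → ℝ
q · x = mkℝ (λ k → q * seq x k) λ ε 0<ε →
  let (N , p) = cauchy x (δ * ε) (δε-pos ε 0<ε)
  in N , λ m n N≤m N≤n → ℚ.≤-trans
      (ℚ.≤-reflexive (trans (cong ∣_∣
        (+-*-Solver.solve 3 (λ q a b → q :* a :- q :* b := q :* (a :- b)) refl
          q (seq x m) (seq x n)))
        (ℚ.∣p*q∣≡∣p∣*∣q∣ q (seq x m - seq x n))))
      (ℚ.≤-trans
        (ℚ.*-monoˡ-≤-nonNeg ∣ q ∣ {{ℚ.∣-∣-nonNeg q}} (p m n N≤m N≤n))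
        (bound ε 0<ε))
  where
  open +-*-Solver using (_:+_; _:-_; _:*_; _:=_)
  c : ℚ
  c = ∣ q ∣ + 1ℚ
  instance
    c-pos : ℚ.Positive c
    c-pos = ℚ.nonNeg+pos⇒pos ∣ q ∣ {{ℚ.∣-∣-nonNeg q}} 1ℚ
    c-nonZero : ℚ.NonZero c
    c-nonZero = ℚ.pos⇒nonZero c
  δ : ℚ
  δ = ℚ.1/ c
  δε-pos : ∀ ε → 0ℚ < ε → 0ℚ < δ * ε
  δε-pos ε 0<ε = subst (_< δ * ε) (ℚ.*-zeroʳ δ)
    (ℚ.*-monoʳ-<-pos δ {{ℚ.1/pos⇒pos c}} 0<ε)
  ∣q∣≤c : ∣ q ∣ ≤ c
  ∣q∣≤c = subst (_≤ c) (ℚ.+-identityʳ ∣ q ∣) (ℚ.+-monoʳ-≤ ∣ q ∣ (ℚ.nonNegative⁻¹ 1ℚ))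
  bound : ∀ ε → 0ℚ < ε → ∣ q ∣ * (δ * ε) ≤ ε
  bound ε 0<ε = ℚ.≤-trans
    (ℚ.*-monoʳ-≤-nonNeg (δ * ε) {{ℚ.nonNegative (ℚ.<⇒≤ (δε-pos ε 0<ε))}} ∣q∣≤c)
    (ℚ.≤-reflexive (trans (sym (ℚ.*-assoc c δ ε))
      (trans (cong (_* ε) (ℚ.*-inverseʳ c)) (ℚ.*-identityˡ ε))))

_-ᴿ_ : ℝ → ℝ → ℝ
x -ᴿ y = mkℝ (λ k → seq x k - seq y k) λ ε 0<ε →
  let (N₁ , p₁) = cauchy x (½ * ε) (half-pos 0<ε)
      (N₂ , p₂) = cauchy y (½ * ε) (half-pos 0<ε)
  in N₁ ℕ.⊔ N₂ , λ m n N≤m N≤n →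
    subst (∣ (seq x m - seq y m) - (seq x n - seq y n) ∣ ≤_) (halves ε)
      (ℚ.≤-trans
        (subst (λ z → ∣ z ∣ ≤ ∣ seq x m - seq x n ∣ + ∣ seq y m - seq y n ∣)
          (+-*-Solver.solve 4 (λ a b c d → (a :- b) :- (c :- d) := (a :- c) :- (b :- d)) refl
            (seq x m) (seq x n) (seq y m) (seq y n))
          (ℚ.∣p-q∣≤∣p∣+∣q∣ (seq x m - seq x n) (seq y m - seq y n)))
        (ℚ.+-mono-≤
          (p₁ m n (ℕ.m⊔n≤o⇒m≤o N₁ N₂ N≤m) (ℕ.m⊔n≤o⇒m≤o N₁ N₂ N≤n))
          (p₂ m n (ℕ.m⊔n≤o⇒n≤o N₁ N₂ N≤m) (ℕ.m⊔n≤o⇒n≤o N₁ N₂ N≤n))))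
  where open +-*-Solver using (_:-_; _:=_)

∣_∣ᴿ : ℝ → ℝ
∣ x ∣ᴿ = mkℝ (λ k → ∣ seq x k ∣) λ ε 0<ε →
  let (N , p) = cauchy x ε 0<ε
  in N , λ m n N≤m N≤n → ℚ.≤-trans (∣∣-lip (seq x m) (seq x n)) (p m n N≤m N≤n)

_≤ᴿ_ : ℝ → ℝ → Set
x ≤ᴿ y = ∀ ε → 0ℚ < ε → ∃[ N ] ∀ k → N ℕ.≤ k → seq x k ≤ seq y k + ε

IsCauchyᴿ : (ℕ → ℝ) → Set
IsCauchyᴿ s = ∀ ε → 0ℚ < ε → ∃[ N ] ∀ m n → N ℕ.≤ m → N ℕ.≤ n → ∣ s m -ᴿ s n ∣ᴿ ≤ᴿ fromℚ ε

_ConvergesTo_ : (ℕ → ℝ) → ℝ → Set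
s ConvergesTo x = ∀ ε → 0ℚ < ε → ∃[ N ] ∀ n → N ℕ.≤ n → ∣ s n -ᴿ x ∣ᴿ ≤ᴿ fromℚ ε

-- A rational within 1/(k+1) of the k-th real; `lim` is the sequence of these.
private
  index : (ℕ → ℝ) → ℕ → ℕ
  index s k = proj₁ (cauchy (s k) (+ 1 / suc k) (inv-pos k))

diagonal : (ℕ → ℝ) → ℕ → ℚ
diagonal s k = seq (s k) (index s k)

diagonal-close : ∀ s k j → index s k ℕ.≤ j → ∣ seq (s k) j - diagonal s k ∣ ≤ + 1 / suc k
diagonal-close s k j i≤j =
  proj₂ (cauchy (s k) (+ 1 / suc k) (inv-pos k)) j (index s k) i≤j ℕ.≤-refl

private
  quarters : ∀ ε → ½ * (½ * ε) + ((½ * (½ * ε) + ½ * (½ * ε)) + ½ * (½ * ε)) ≡ ε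
  quarters ε = trans
    (+-*-Solver.solve 1 (λ h → h :+ ((h :+ h) :+ h) := (h :+ h) :+ (h :+ h)) refl (½ * (½ * ε)))
    (trans (cong₂ _+_ (halves (½ * ε)) (halves (½ * ε))) (halves ε))
    where open +-*-Solver using (_:+_; _:=_)

diagonal-cauchy : ∀ s → IsCauchyᴿ s → IsCauchy (diagonal s)
diagonal-cauchy s c ε 0<ε =
  let δ         = ½ * (½ * ε)
      0<δ       = half-pos (half-pos 0<ε)
      (N₁ , p₁) = c δ 0<δ
      (N₂ , p₂) = archimedean δ 0<δ
  in N₁ ℕ.⊔ N₂ , λ m n N≤m N≤n →
    let (J , p₃) = p₁ m n (ℕ.m⊔n≤o⇒m≤o N₁ N₂ N≤m) (ℕ.m⊔n≤o⇒m≤o N₁ N₂ N≤n) δ 0<δ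
        j   = J ℕ.⊔ (index s m ℕ.⊔ index s n)
        j≥J = ℕ.m≤m⊔n J (index s m ℕ.⊔ index s n)
        j≥′ = ℕ.m≤n⊔m J (index s m ℕ.⊔ index s n)
        j≥m = ℕ.m⊔n≤o⇒m≤o (index s m) (index s n) j≥′
        j≥n = ℕ.m⊔n≤o⇒n≤o (index s m) (index s n) j≥′
        dm  = diagonal s m
        dn  = diagonal s n
        sm  = seq (s m) j
        sn  = seq (s n) j
    in ℚ.≤-trans (tri dm sm dn)
       (ℚ.≤-trans (ℚ.+-monoʳ-≤ ∣ dm - sm ∣ (tri sm sn dn))
       (ℚ.≤-trans (ℚ.+-mono-≤
          (subst (_≤ δ) (dist-sym sm dm)
            (ℚ.≤-trans (diagonal-close s m j j≥m) (p₂ m (ℕ.m⊔n≤o⇒n≤o N₁ N₂ N≤m))))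
          (ℚ.+-mono-≤ (p₃ j j≥J)
            (ℚ.≤-trans (diagonal-close s n j j≥n) (p₂ n (ℕ.m⊔n≤o⇒n≤o N₁ N₂ N≤n)))))
        (ℚ.≤-reflexive (quarters ε))))

lim : (s : ℕ → ℝ) → IsCauchyᴿ s → ℝ
lim s c = mkℝ (diagonal s) (diagonal-cauchy s c)

lim-converges : ∀ s c → s ConvergesTo lim s c
lim-converges s c ε 0<ε =
  let (N₁ , p₁) = archimedean (½ * ε) (half-pos 0<ε)
      (N₂ , p₂) = diagonal-cauchy s c (½ * ε) (half-pos 0<ε)
  in N₁ ℕ.⊔ N₂ , λ n N≤n η 0<η → index s n ℕ.⊔ N₂ , λ k K≤k →
    ℚ.≤-trans (tri (seq (s n) k) (diagonal s n) (diagonal s k))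
    (ℚ.≤-trans (ℚ.+-mono-≤
       (ℚ.≤-trans (diagonal-close s n k (ℕ.m⊔n≤o⇒m≤o (index s n) N₂ K≤k))
                  (p₁ n (ℕ.m⊔n≤o⇒m≤o N₁ N₂ N≤n)))
       (p₂ n k (ℕ.m⊔n≤o⇒n≤o N₁ N₂ N≤n) (ℕ.m⊔n≤o⇒n≤o (index s n) N₂ K≤k)))
    (ℚ.≤-trans (ℚ.≤-reflexive (trans (halves ε) (sym (ℚ.+-identityʳ ε))))
               (ℚ.+-monoʳ-≤ ε (ℚ.<⇒≤ 0<η))))

-- The left Riemann sum of t ↦ 1/t over [1 , n] with mesh 1/m, where
-- m = k + 1: the sample points are t = 1 + i/m = (m + i)/m.
riemannSum : ℕ → ℕ → ℚ
riemannSum n k =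
  let m = suc k in Σ[ i < (n ℕ.∸ 1) ℕ.* m ] ((+ m / (m ℕ.+ i)) * (+ 1 / m))

private
  riemann-term : ∀ k i → (+ suc k / (suc k ℕ.+ i)) * (+ 1 / suc k) ≡ inv (suc k ℕ.+ i)
  riemann-term k i = trans (fromℚᵘ-homo-* (mkℚᵘ (+ suc k) (k ℕ.+ i)) (mkℚᵘ (+ 1) k))
    (ℚ.fromℚᵘ-cong {mkℚᵘ (+ suc k) (k ℕ.+ i) ℚᵘ.* mkℚᵘ (+ 1) k} {mkℚᵘ (+ 1) (k ℕ.+ i)} (ℚᵘ.*≡* (cong +_ (lem (suc k) (suc k ℕ.+ i)))))
    where
    lem : ∀ m t → (m ℕ.* 1) ℕ.* t ≡ 1 ℕ.* (t ℕ.* m)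
    lem = ℕ-Tactic.solve-∀

riemannSum≡h : ∀ n k → riemannSum n k ≡ h (suc k) ((n ℕ.∸ 1) ℕ.* suc k)
riemannSum≡h n k = Σ-cong ((n ℕ.∸ 1) ℕ.* suc k) (riemann-term k)

private
  riemann-dist : ∀ n k l → ∣ riemannSum n k - riemannSum n l ∣ ≤ inv (suc k) + inv (suc l)
  riemann-dist n k l = ℚ.≤-trans (tri (riemannSum n k) common (riemannSum n l))
    (ℚ.+-mono-≤ (half k l) (subst (_≤ inv (suc l)) side (half l k)))
    where
    ℓ = n ℕ.∸ 1
    common = h (suc k ℕ.* suc l) ((ℓ ℕ.* suc k) ℕ.* suc l)
    half : ∀ k l → ∣ riemannSum n k - h (suc k ℕ.* suc l) ((ℓ ℕ.* suc k) ℕ.* suc l) ∣ ≤ inv (suc k)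
    half k l = subst
      (λ z → ∣ z - h (suc k ℕ.* suc l) ((ℓ ℕ.* suc k) ℕ.* suc l) ∣ ≤ inv (suc k))
      (sym (riemannSum≡h n k)) (refine-dist k (ℓ ℕ.* suc k) l)
    swap : h (suc l ℕ.* suc k) ((ℓ ℕ.* suc l) ℕ.* suc k) ≡ common
    swap = cong₂ h (ℕ.*-comm (suc l) (suc k)) (lem ℓ (suc l) (suc k))
      where
      lem : ∀ x y z → (x ℕ.* y) ℕ.* z ≡ (x ℕ.* z) ℕ.* y
      lem = ℕ-Tactic.solve-∀
    side : ∣ riemannSum n l - h (suc l ℕ.* suc k) ((ℓ ℕ.* suc l) ℕ.* suc k) ∣
         ≡ ∣ common - riemannSum n l ∣
    side = trans (cong (λ z → ∣ riemannSum n l - z ∣) swap) (dist-sym (riemannSum n l) common)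

-- log n = ∫₁ⁿ dt/t
log : (n : ℕ) .{{_ : ℕ.NonZero n}} → ℝ
log n = mkℝ (riemannSum n) λ ε 0<ε →
  let (N , p) = archimedean (½ * ε) (half-pos 0<ε)
  in N , λ k l N≤k N≤l → ℚ.≤-trans (riemann-dist n k l)
    (ℚ.≤-trans (ℚ.+-mono-≤ (p k N≤k) (p l N≤l)) (ℚ.≤-reflexive (halves ε)))

-- The k-th term is the one for n = k + 1.
harmonic-log : ℕ → ℝ
harmonic-log k = fromℚ (harmonic (suc k)) -ᴿ log (suc k)

private
  harmonic-log-step : ∀ a ℓ k →
    ∣ seq (harmonic-log (a ℕ.+ ℓ)) k - seq (harmonic-log a) k ∣ ≤ inv (suc a)
  harmonic-log-step a ℓ k = subst (λ z → ∣ z ∣ ≤ inv (suc a)) (sym rearrange) (refine-dist′ a ℓ k)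
    where
    open +-*-Solver using (_:+_; _:-_; _:=_)
    m = suc k
    base-log : riemannSum (suc (a ℕ.+ ℓ)) k ≡ riemannSum (suc a) k + h (suc a ℕ.* m) (ℓ ℕ.* m)
    base-log = trans (riemannSum≡h (suc (a ℕ.+ ℓ)) k)
      (trans (cong (h m) (ℕ.*-distribʳ-+ m a ℓ))
      (trans (h-split m (a ℕ.* m) (ℓ ℕ.* m))
             (cong (_+ h (suc a ℕ.* m) (ℓ ℕ.* m)) (sym (riemannSum≡h (suc a) k)))))
    rearrange : seq (harmonic-log (a ℕ.+ ℓ)) k - seq (harmonic-log a) k
              ≡ h (suc (suc a)) ℓ - h (suc a ℕ.* m) (ℓ ℕ.* m)
    rearrange = trans
      (cong₂ (λ u v → (u - v) - (harmonic (suc a) - riemannSum (suc a) k))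
        (h-split 1 (suc a) ℓ) base-log)
      (+-*-Solver.solve 4
        (λ x y r q → ((x :+ y) :- (r :+ q)) :- (x :- r) := y :- q) refl
        (harmonic (suc a)) (h (suc (suc a)) ℓ) (riemannSum (suc a) k)
        (h (suc a ℕ.* m) (ℓ ℕ.* m)))

  harmonic-log-dist : ∀ a b k → a ℕ.≤ b →
    ∣ seq (harmonic-log b) k - seq (harmonic-log a) k ∣ ≤ inv (suc a)
  harmonic-log-dist a b k a≤b =
    subst (λ z → ∣ seq (harmonic-log z) k - seq (harmonic-log a) k ∣ ≤ inv (suc a))
      (ℕ.m+[n∸m]≡n a≤b) (harmonic-log-step a (b ℕ.∸ a) k)

harmonic-log-cauchy : IsCauchyᴿ harmonic-log
harmonic-log-cauchy ε 0<ε =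
  let (N , p) = archimedean ε 0<ε
  in N , λ m n N≤m N≤n η 0<η → 0 , λ k _ →
    ℚ.≤-trans (close m n k N p N≤m N≤n)
      (ℚ.≤-trans (ℚ.≤-reflexive (sym (ℚ.+-identityʳ ε))) (ℚ.+-monoʳ-≤ ε (ℚ.<⇒≤ 0<η)))
  where
  close : ∀ m n k N → (∀ i → N ℕ.≤ i → inv (suc i) ≤ ε) → N ℕ.≤ m → N ℕ.≤ n →
    ∣ seq (harmonic-log m) k - seq (harmonic-log n) k ∣ ≤ ε
  close m n k N p N≤m N≤n with ℕ.≤-total m n
  ... | inj₂ n≤m = ℚ.≤-trans (harmonic-log-dist n m k n≤m) (p n N≤n)
  ... | inj₁ m≤n = subst (_≤ ε) (dist-sym (seq (harmonic-log n) k) (seq (harmonic-log m) k))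
    (ℚ.≤-trans (harmonic-log-dist m n k m≤n) (p m N≤m))

-- The Euler–Mascheroni constant limₙ (1 + 1/2 + … + 1/n - log n); by
-- `lim-converges`, `harmonic-log` does converge to it.
γ : ℝ
γ = lim harmonic-log harmonic-log-cauchy

{-# OPTIONS --safe #-}
-- Read from its end, the random path P_{n+1} without its first step is
-- distributed as P_n, because 1/C(n+1,j) + 1/C(n+1,j+1) is the multiple
-- (n+2)/(n+1) of 1/C(n,j). Hence E(Z_{n+1}) - E(Z_n) is the probability
-- [n+1 even]/(n+2) of starting at 0, and E(Z_{2m}) = E(Z_{2m+1}) = H_{2m+1} - H_m/2.
--
-- It remains to expand harmonic numbers. With c(x) = 1/(2x) - 1/(12x²), the
-- increment of H_x - c(x) - log x is O(x⁻⁵), as log (1 + 1/x) is within O(x⁻⁵) of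
-- its fourth Taylor polynomial at 1/x; the increments telescope against x⁻⁴, so
-- H_x = log x + γ + c(x) + O(x⁻⁴). This is applied to x = n and n/2 for even n, and
-- to x = n, n+1 and (n+1)/2 for odd n, where log (n+1) drops out since H_{n+1} can
-- also be read as H_n + 1/(n+1).
module Submission where

open import Defs
open Aux
open import Data.Bool.Base using (true; false)
open import Data.Empty.Irrelevant using (⊥-elim)
open import Data.Integer.Base as ℤ using (ℤ; +_; 0ℤ)
import Data.Integer.Properties as ℤ
open import Data.Integer.Solver renaming (module +-*-Solver to ℤ-Solver)
open import Data.List.Base using (List; []; _∷_; _++_; map; filter; foldr; length; upTo; applyUpTo)
import Data.List.Properties as List
open import Data.Nat.Base as ℕ using (ℕ; zero; suc; z≤n; s≤s)
open import Data.Nat.Combinatorics using (_C_; nCk+nC[k+1]≡[n+1]C[k+1]; nCk≡nC[n∸k]; nCn≡1; nC1≡n; k>n⇒nCk≡0)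
open import Data.Nat.Divisibility using (divides)
import Data.Nat.Properties as ℕ
import Data.Nat.Tactic.RingSolver as ℕ-Tactic
open import Data.Product.Base using (∃; ∃-syntax; _,_)
open import Data.Rational.Base as ℚ
  using (ℚ; 0ℚ; 1ℚ; ½; _+_; _*_; _-_; -_; ∣_∣; _≤_; _<_; _/_)
import Data.Rational.Properties as ℚ
open import Data.Rational.Solver using (module +-*-Solver)
open import Data.Rational.Unnormalised.Base as ℚᵘ using (mkℚᵘ)
open import Data.Sum.Base using (_⊎_; inj₁; inj₂)
open import Data.Vec.Base using (Vec; []; _∷_)
open import Function.Base using (_∘_)
open import Relation.Binary.PropositionalEquality hiding ([_])
open import Relation.Nullary.Decidable using (Dec; yes; no; does)
open import Relation.Nullary.Negation using (¬_; contradiction)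
open import Relation.Unary using (Decidable)
open +-*-Solver using (solve; con; _:+_; _:*_; _:-_; :-_; _:=_)

-- Order, inverses of naturals and finite sums in the rationals

0≤+ : ∀ {p q} → 0ℚ ≤ p → 0ℚ ≤ q → 0ℚ ≤ p + q
0≤+ = ℚ.+-mono-≤

*-mono-≤-nonNeg : ∀ {p p′ q q′} → 0ℚ ≤ p → 0ℚ ≤ q → p ≤ p′ → q ≤ q′ → p * q ≤ p′ * q′
*-mono-≤-nonNeg {p} {p′} {q} {q′} 0≤p 0≤q p≤p′ q≤q′ = ℚ.≤-trans
  (ℚ.*-monoʳ-≤-nonNeg q {{ℚ.nonNegative 0≤q}} p≤p′)
  (ℚ.*-monoˡ-≤-nonNeg p′ {{ℚ.nonNegative (ℚ.≤-trans 0≤p p≤p′)}} q≤q′)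

0≤* : ∀ {p q} → 0ℚ ≤ p → 0ℚ ≤ q → 0ℚ ≤ p * q
0≤* {p} {q} 0≤p 0≤q = subst (_≤ p * q) (ℚ.*-zeroˡ 0ℚ) (*-mono-≤-nonNeg ℚ.≤-refl ℚ.≤-refl 0≤p 0≤q)

∣+∣≤ : ∀ {p q c d} → ∣ p ∣ ≤ c → ∣ q ∣ ≤ d → ∣ p + q ∣ ≤ c + d
∣+∣≤ {p} {q} u v = ℚ.≤-trans (ℚ.∣p+q∣≤∣p∣+∣q∣ p q) (ℚ.+-mono-≤ u v)

∣-∣≤ : ∀ {p q c d} → ∣ p ∣ ≤ c → ∣ q ∣ ≤ d → ∣ p - q ∣ ≤ c + d
∣-∣≤ {p} {q} u v = ℚ.≤-trans (ℚ.∣p-q∣≤∣p∣+∣q∣ p q) (ℚ.+-mono-≤ u v)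

∣*∣≤ : ∀ {p q c d} → ∣ p ∣ ≤ c → ∣ q ∣ ≤ d → ∣ p * q ∣ ≤ c * d
∣*∣≤ {p} {q} u v = subst (_≤ _) (sym (ℚ.∣p*q∣≡∣p∣*∣q∣ p q))
  (*-mono-≤-nonNeg (ℚ.0≤∣p∣ p) (ℚ.0≤∣p∣ q) u v)

0≤p≤c⇒∣p∣≤c : ∀ {p c} → 0ℚ ≤ p → p ≤ c → ∣ p ∣ ≤ c
0≤p≤c⇒∣p∣≤c 0≤p p≤c = subst (_≤ _) (sym (ℚ.0≤p⇒∣p∣≡p 0≤p)) p≤c

p≤p+q : ∀ p {q} → 0ℚ ≤ q → p ≤ p + q
p≤p+q p {q} 0≤q = subst (_≤ p + q) (ℚ.+-identityʳ p) (ℚ.+-monoʳ-≤ p 0≤q)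

ι-+ : ∀ m n → ι (m ℕ.+ n) ≡ ι m + ι n
ι-+ m n = sym (trans (fromℚᵘ-homo-+ (mkℚᵘ (+ m) 0) (mkℚᵘ (+ n) 0))
  (ℚ.fromℚᵘ-cong {mkℚᵘ (+ m) 0 ℚᵘ.+ mkℚᵘ (+ n) 0} {mkℚᵘ (+ (m ℕ.+ n)) 0}
    (ℚᵘ.*≡* (cong (ℤ._* (+ 1)) (cong₂ ℤ._+_ (ℤ.*-identityʳ (+ m)) (ℤ.*-identityʳ (+ n)))))))

ι-* : ∀ m n → ι (m ℕ.* n) ≡ ι m * ι n
ι-* m n = sym (trans (fromℚᵘ-homo-* (mkℚᵘ (+ m) 0) (mkℚᵘ (+ n) 0))
  (ℚ.fromℚᵘ-cong {mkℚᵘ (+ m) 0 ℚᵘ.* mkℚᵘ (+ n) 0} {mkℚᵘ (+ (m ℕ.* n)) 0}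
    (ℚᵘ.*≡* (cong (ℤ._* (+ 1)) (sym (ℤ.pos-* m n))))))

ι-nonNeg : ∀ n → 0ℚ ≤ ι n
ι-nonNeg zero    = ℚ.≤-refl
ι-nonNeg (suc n) = subst (0ℚ ≤_) (sym (ι-suc n)) (0≤+ (ι-nonNeg n) (ℚ.nonNegative⁻¹ 1ℚ))

ι-mono : ∀ {m n} → m ℕ.≤ n → ι m ≤ ι n
ι-mono {m} {n} m≤n = subst (ι m ≤_) (trans (sym (ι-+ m (n ℕ.∸ m))) (cong ι (ℕ.m+[n∸m]≡n m≤n)))
  (p≤p+q (ι m) (ι-nonNeg (n ℕ.∸ m)))

ι*inv≡1 : ∀ n → ι (suc n) * inv (suc n) ≡ 1ℚ
ι*inv≡1 n = trans (cong (λ z → ι (suc n) * inv z) (sym (ℕ.*-identityˡ (suc n)))) (ι*inv 0 n)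

inv-unique : ∀ n {p} → ι (suc n) * p ≡ 1ℚ → p ≡ inv (suc n)
inv-unique n {p} e = trans
  (solve 3 (λ x p q → p := p :* (x :* q) :+ p :* (con 1ℚ :- x :* q)) refl (ι (suc n)) p q)
  (trans (cong (λ z → p * z + p * (1ℚ - z)) (ι*inv≡1 n))
  (trans (solve 1 (λ p → p :* con 1ℚ :+ p :* (con 1ℚ :- con 1ℚ) := con 1ℚ :* p) refl p)
  (trans (cong (_* p) (sym (ι*inv≡1 n)))
  (trans (solve 3 (λ x p q → (x :* q) :* p := (x :* p) :* q) refl (ι (suc n)) p q)
  (trans (cong (_* q) e) (ℚ.*-identityˡ q))))))
  where q = inv (suc n)

-- The convention `inv 0 = 0ℚ` extends the rule to zero factors.
inv-* : ∀ m n → inv (m ℕ.* n) ≡ inv m * inv n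
inv-* zero    n       = sym (ℚ.*-zeroˡ (inv n))
inv-* (suc m) zero    = trans (cong inv (ℕ.*-zeroʳ m)) (sym (ℚ.*-zeroʳ (inv (suc m))))
inv-* (suc m) (suc n) = sym (inv-unique (n ℕ.+ m ℕ.* suc n)
  (trans (cong (_* (p * q)) (ι-* (suc m) (suc n)))
  (trans (solve 4 (λ x y p q → (x :* y) :* (p :* q) := (x :* p) :* (y :* q)) refl (ι (suc m)) (ι (suc n)) p q)
  (cong₂ _*_ (ι*inv≡1 m) (ι*inv≡1 n)))))
  where
  p = inv (suc m)
  q = inv (suc n)

inv≤1 : ∀ n → inv n ≤ 1ℚ
inv≤1 zero    = ℚ.nonNegative⁻¹ 1ℚ
inv≤1 (suc n) = inv-anti 0 n z≤n

-- Partial fractions. The polynomial identities below in a = 1/x and b = 1/(x + 1) rest on this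
-- relation b = a - a b.
inv-suc : ∀ n → inv (suc (suc n)) ≡ inv (suc n) - inv (suc n) * inv (suc (suc n))
inv-suc n = trans
  (solve 2 (λ a b → b := con 1ℚ :* b :+ a :* con 1ℚ :- a :* con 1ℚ) refl a b)
  (trans (cong₂ (λ u v → u * b + a * 1ℚ - a * v) (sym (ι*inv≡1 n)) (sym e))
  (solve 3 (λ x a b → x :* a :* b :+ a :* con 1ℚ :- a :* ((x :+ con 1ℚ) :* b) := a :- a :* b) refl (ι (suc n)) a b))
  where
  a = inv (suc n)
  b = inv (suc (suc n))
  e : (ι (suc n) + 1ℚ) * b ≡ 1ℚ
  e = trans (cong (_* b) (sym (ι-suc (suc n)))) (ι*inv≡1 (suc n))

1/^1 : ∀ n → 1/ suc n ^ 1 ≡ inv (suc n)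
1/^1 n = cong inv (ℕ.*-identityʳ (suc n))

1/^-suc : ∀ n k → 1/ suc n ^ suc k ≡ inv (suc n) * 1/ suc n ^ k
1/^-suc n k = trans (lem (suc n ℕ.^ suc k) {{ℕ.m^n≢0 (suc n) (suc k)}})
  (trans (inv-* (suc n) (suc n ℕ.^ k))
  (cong (inv (suc n) *_) (sym (lem (suc n ℕ.^ k) {{ℕ.m^n≢0 (suc n) k}}))))
  where
  lem : ∀ m .{{_ : ℕ.NonZero m}} → + 1 / m ≡ inv m
  lem (suc m) = refl

Σ-+ : ∀ n f g → Σ< n (λ i → f i + g i) ≡ Σ< n f + Σ< n g
Σ-+ zero    f g = refl
Σ-+ (suc n) f g = trans (cong (_+ (f n + g n)) (Σ-+ n f g))
  (solve 4 (λ a b c d → (a :+ b) :+ (c :+ d) := (a :+ c) :+ (b :+ d)) refl (Σ< n f) (Σ< n g) (f n) (g n))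

Σ-*ˡ : ∀ n c f → c * Σ< n f ≡ Σ< n (λ i → c * f i)
Σ-*ˡ zero    c f = ℚ.*-zeroʳ c
Σ-*ˡ (suc n) c f = trans (ℚ.*-distribˡ-+ c (Σ< n f) (f n)) (cong (_+ c * f n) (Σ-*ˡ n c f))

Σ-cong< : ∀ n {f g : ℕ → ℚ} → (∀ i → i ℕ.< n → f i ≡ g i) → Σ< n f ≡ Σ< n g
Σ-cong< zero    p = refl
Σ-cong< (suc n) p = cong₂ _+_ (Σ-cong< n (λ i i<n → p i (ℕ.m<n⇒m<1+n i<n))) (p n ℕ.≤-refl)

Σ-head : ∀ n f → Σ< (suc n) f ≡ f 0 + Σ< n (λ i → f (suc i))
Σ-head n f = trans (Σ-split 1 n f) (cong (_+ Σ< n (λ i → f (suc i))) (ℚ.+-identityˡ (f 0)))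

-- Binomial coefficients

nC0≡1 : ∀ n → n C 0 ≡ 1
nC0≡1 n = trans (nCk≡nC[n∸k] {0} {n} z≤n) (nCn≡1 n)

-- Absorption, by induction on n: Pascal's rule brings in the hypothesis at both k and k + 1.
[k+1]*[n+1]C[k+1]≡[n+1]*nCk : ∀ n k → suc k ℕ.* (suc n C suc k) ≡ suc n ℕ.* (n C k)
[k+1]*[n+1]C[k+1]≡[n+1]*nCk n zero = trans (ℕ.*-identityˡ (suc n C 1))
  (trans (nC1≡n (suc n)) (sym (trans (cong (suc n ℕ.*_) (nC0≡1 n)) (ℕ.*-identityʳ (suc n)))))
[k+1]*[n+1]C[k+1]≡[n+1]*nCk zero (suc k) = trans
  (cong (suc (suc k) ℕ.*_) (k>n⇒nCk≡0 {1} {suc (suc k)} (s≤s (s≤s z≤n))))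
  (trans (ℕ.*-zeroʳ k) (sym (cong (1 ℕ.*_) (k>n⇒nCk≡0 {0} {suc k} (s≤s z≤n)))))
[k+1]*[n+1]C[k+1]≡[n+1]*nCk (suc n) (suc k) = begin
  suc (suc k) ℕ.* (suc (suc n) C suc (suc k))
    ≡⟨ cong (suc (suc k) ℕ.*_) (sym (nCk+nC[k+1]≡[n+1]C[k+1] (suc n) (suc k))) ⟩
  suc (suc k) ℕ.* (c ℕ.+ (suc n C suc (suc k)))
    ≡⟨ expand k c (suc n C suc (suc k)) ⟩
  c ℕ.+ suc k ℕ.* c ℕ.+ suc (suc k) ℕ.* (suc n C suc (suc k))
    ≡⟨ cong₂ (λ u v → c ℕ.+ u ℕ.+ v) ([k+1]*[n+1]C[k+1]≡[n+1]*nCk n k) ([k+1]*[n+1]C[k+1]≡[n+1]*nCk n (suc k)) ⟩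
  c ℕ.+ suc n ℕ.* (n C k) ℕ.+ suc n ℕ.* (n C suc k)
    ≡⟨ collect n c (n C k) (n C suc k) ⟩
  c ℕ.+ suc n ℕ.* (n C k ℕ.+ n C suc k)
    ≡⟨ cong (λ z → c ℕ.+ suc n ℕ.* z) (nCk+nC[k+1]≡[n+1]C[k+1] n k) ⟩
  suc (suc n) ℕ.* c ∎
  where
  open ≡-Reasoning
  c = suc n C suc k
  expand : ∀ k x y → suc (suc k) ℕ.* (x ℕ.+ y) ≡ x ℕ.+ suc k ℕ.* x ℕ.+ suc (suc k) ℕ.* y
  expand = ℕ-Tactic.solve-∀
  collect : ∀ n c x y → c ℕ.+ suc n ℕ.* x ℕ.+ suc n ℕ.* y ≡ c ℕ.+ suc n ℕ.* (x ℕ.+ y)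
  collect = ℕ-Tactic.solve-∀

-- This is (n + 1 - k) C(n+1,k) = (n + 1) C(n,k), arranged to avoid truncated subtraction.
[n+1]*[n+1]Ck≡k*[n+1]Ck+[n+1]*nCk : ∀ n k → suc n ℕ.* (suc n C k) ≡ k ℕ.* (suc n C k) ℕ.+ suc n ℕ.* (n C k)
[n+1]*[n+1]Ck≡k*[n+1]Ck+[n+1]*nCk n zero = cong (suc n ℕ.*_) (trans (nC0≡1 (suc n)) (sym (nC0≡1 n)))
[n+1]*[n+1]Ck≡k*[n+1]Ck+[n+1]*nCk n (suc k) = trans
  (cong (suc n ℕ.*_) (sym (nCk+nC[k+1]≡[n+1]C[k+1] n k)))
  (trans (ℕ.*-distribˡ-+ (suc n) (n C k) (n C suc k))
         (cong (ℕ._+ suc n ℕ.* (n C suc k)) (sym ([k+1]*[n+1]C[k+1]≡[n+1]*nCk n k))))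

C-pos : ∀ n k → k ℕ.≤ n → 0 ℕ.< n C k
C-pos n       zero    _         = subst (0 ℕ.<_) (sym (nC0≡1 n)) (s≤s z≤n)
C-pos (suc n) (suc k) (s≤s k≤n) = subst (0 ℕ.<_) (nCk+nC[k+1]≡[n+1]C[k+1] n k)
  (ℕ.<-≤-trans (C-pos n k k≤n) (ℕ.m≤m+n (n C k) (n C suc k)))

ι*inv≡1′ : ∀ n → 0 ℕ.< n → ι n * inv n ≡ 1ℚ
ι*inv≡1′ (suc n) _ = ι*inv≡1 n

-- Clearing denominators leaves N c (p + q) = (N + 1) p q in the naturals, which `regroup` derives
-- from the two recurrences above. In probabilistic terms, dropping the first step of a random path
-- of length n + 1 leaves a random path of length n.
inv-weights : ∀ n k → k ℕ.≤ n →
  inv (suc (suc n)) * (inv (suc n C k) + inv (suc n C suc k)) ≡ inv (suc n) * inv (n C k)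
inv-weights n k k≤n = begin
  r′ * (p′ + q′)
    -- The factors 1 are placeholders for products `ι x * inv x`, which bring both fractions over a
    -- common denominator.
    ≡⟨ solve 3 (λ r′ p′ q′ → r′ :* (p′ :+ q′) := con 1ℚ :* con 1ℚ :* (con 1ℚ :* r′ :* p′ :+ con 1ℚ :* r′ :* q′)) refl r′ p′ q′ ⟩
  1ℚ * 1ℚ * (1ℚ * r′ * p′ + 1ℚ * r′ * q′)
    ≡⟨ cong₂ (λ u v → u * v * (1ℚ * r′ * p′ + 1ℚ * r′ * q′)) (sym N*) (sym c*) ⟩
  (ι N * N′) * (ι c * c′) * (1ℚ * r′ * p′ + 1ℚ * r′ * q′)
    ≡⟨ cong₂ (λ u v → (ι N * N′) * (ι c * c′) * (u * r′ * p′ + v * r′ * q′)) (sym q*) (sym p*) ⟩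
  (ι N * N′) * (ι c * c′) * ((ι q * q′) * r′ * p′ + (ι p * p′) * r′ * q′)
    ≡⟨ solve 9 (λ N N′ c c′ p p′ q q′ r′ →
         (N :* N′) :* (c :* c′) :* ((q :* q′) :* r′ :* p′ :+ (p :* p′) :* r′ :* q′)
         := (N :* c :* (p :+ q)) :* (N′ :* c′ :* (p′ :* q′ :* r′))) refl
         (ι N) N′ (ι c) c′ (ι p) p′ (ι q) q′ r′ ⟩
  (ι N * ι c * (ι p + ι q)) * (N′ * c′ * (p′ * q′ * r′))
    ≡⟨ cong (_* (N′ * c′ * (p′ * q′ * r′))) cross ⟩
  (ι (suc N) * ι p * ι q) * (N′ * c′ * (p′ * q′ * r′))
    ≡⟨ solve 8 (λ r p q N′ c′ p′ q′ r′ →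
         (r :* p :* q) :* (N′ :* c′ :* (p′ :* q′ :* r′))
         := N′ :* c′ :* ((p :* p′) :* (q :* q′) :* (r :* r′))) refl
         (ι (suc N)) (ι p) (ι q) N′ c′ p′ q′ r′ ⟩
  N′ * c′ * ((ι p * p′) * (ι q * q′) * (ι (suc N) * r′))
    ≡⟨ cong (N′ * c′ *_) (cong₂ _*_ (cong₂ _*_ p* q*) (ι*inv≡1 N)) ⟩
  N′ * c′ * 1ℚ
    ≡⟨ ℚ.*-identityʳ (N′ * c′) ⟩
  N′ * c′ ∎
  where
  open ≡-Reasoning
  N = suc n
  c = n C k
  p = suc n C k
  q = suc n C suc k
  N′ = inv N
  c′ = inv c
  p′ = inv p
  q′ = inv q
  r′ = inv (suc N)
  N* = ι*inv≡1 n
  c* = ι*inv≡1′ c (C-pos n k k≤n)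
  p* = ι*inv≡1′ p (C-pos (suc n) k (ℕ.m≤n⇒m≤1+n k≤n))
  q* = ι*inv≡1′ q (C-pos (suc n) (suc k) (s≤s k≤n))
  regroup : ∀ N c k p q → N ℕ.* c ≡ suc k ℕ.* q → N ℕ.* p ≡ k ℕ.* p ℕ.+ N ℕ.* c →
            N ℕ.* c ℕ.* (p ℕ.+ q) ≡ suc N ℕ.* p ℕ.* q
  regroup N c k p q e₁ e₂ = begin
    N ℕ.* c ℕ.* (p ℕ.+ q)                 ≡⟨ ℕ.*-distribˡ-+ (N ℕ.* c) p q ⟩
    N ℕ.* c ℕ.* p ℕ.+ N ℕ.* c ℕ.* q       ≡⟨ cong (λ z → z ℕ.* p ℕ.+ N ℕ.* c ℕ.* q) e₁ ⟩
    suc k ℕ.* q ℕ.* p ℕ.+ N ℕ.* c ℕ.* q   ≡⟨ lem₁ k p q (N ℕ.* c) ⟩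
    p ℕ.* q ℕ.+ (k ℕ.* p ℕ.+ N ℕ.* c) ℕ.* q ≡⟨ cong (λ z → p ℕ.* q ℕ.+ z ℕ.* q) (sym e₂) ⟩
    p ℕ.* q ℕ.+ N ℕ.* p ℕ.* q             ≡⟨ lem₂ N p q ⟩
    suc N ℕ.* p ℕ.* q ∎
    where
    lem₁ : ∀ k p q x → suc k ℕ.* q ℕ.* p ℕ.+ x ℕ.* q ≡ p ℕ.* q ℕ.+ (k ℕ.* p ℕ.+ x) ℕ.* q
    lem₁ = ℕ-Tactic.solve-∀
    lem₂ : ∀ N p q → p ℕ.* q ℕ.+ N ℕ.* p ℕ.* q ≡ suc N ℕ.* p ℕ.* q
    lem₂ = ℕ-Tactic.solve-∀
  cross : ι N * ι c * (ι p + ι q) ≡ ι (suc N) * ι p * ι q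
  cross = begin
    ι N * ι c * (ι p + ι q)          ≡⟨ cong₂ _*_ (sym (ι-* N c)) (sym (ι-+ p q)) ⟩
    ι (N ℕ.* c) * ι (p ℕ.+ q)        ≡⟨ sym (ι-* (N ℕ.* c) (p ℕ.+ q)) ⟩
    ι (N ℕ.* c ℕ.* (p ℕ.+ q))        ≡⟨ cong ι (regroup N c k p q (sym ([k+1]*[n+1]C[k+1]≡[n+1]*nCk n k)) ([n+1]*[n+1]Ck≡k*[n+1]Ck+[n+1]*nCk n k)) ⟩
    ι (suc N ℕ.* p ℕ.* q)            ≡⟨ ι-* (suc N ℕ.* p) q ⟩
    ι (suc N ℕ.* p) * ι q            ≡⟨ cong (_* ι q) (ι-* (suc N) p) ⟩
    ι (suc N) * ι p * ι q ∎

-- The expected number of zeros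

private
  variable
    A B : Set

ΣL : (A → ℚ) → List A → ℚ
ΣL f = foldr (λ x r → f x + r) 0ℚ

ΣL-++ : ∀ (f : A → ℚ) xs ys → ΣL f (xs ++ ys) ≡ ΣL f xs + ΣL f ys
ΣL-++ f []       ys = sym (ℚ.+-identityˡ (ΣL f ys))
ΣL-++ f (x ∷ xs) ys = trans (cong (_+_ (f x)) (ΣL-++ f xs ys)) (sym (ℚ.+-assoc (f x) (ΣL f xs) (ΣL f ys)))

ΣL-map : ∀ (f : B → ℚ) (g : A → B) xs → ΣL f (map g xs) ≡ ΣL (f ∘ g) xs
ΣL-map f g = List.foldr-map _ g 0ℚ

ΣL-cong : ∀ {f g : A → ℚ} → (∀ x → f x ≡ g x) → ∀ xs → ΣL f xs ≡ ΣL g xs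
ΣL-cong e []       = refl
ΣL-cong e (x ∷ xs) = cong₂ _+_ (e x) (ΣL-cong e xs)

ΣL-const+ : ∀ c (f : A → ℚ) xs → ΣL (λ x → c + f x) xs ≡ c * ι (length xs) + ΣL f xs
ΣL-const+ c f []       = sym (trans (ℚ.+-identityʳ (c * 0ℚ)) (ℚ.*-zeroʳ c))
ΣL-const+ c f (x ∷ xs) = trans (cong (_+_ (c + f x)) (ΣL-const+ c f xs))
  (trans (solve 4 (λ c y l s → c :+ y :+ (c :* l :+ s) := c :* (l :+ con 1ℚ) :+ (y :+ s)) refl
           c (f x) (ι (length xs)) (ΣL f xs))
         (cong (λ z → c * z + (f x + ΣL f xs)) (sym (ι-suc (length xs)))))

ΣL-applyUpTo : ∀ (f : ℕ → ℚ) g n → ΣL f (applyUpTo g n) ≡ Σ< n (f ∘ g)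
ΣL-applyUpTo f g zero    = refl
ΣL-applyUpTo f g (suc n) = trans (cong (_+_ (f (g 0))) (ΣL-applyUpTo f (g ∘ suc) n)) (sym (Σ-head n (f ∘ g)))

𝔼-map : ∀ (q : ℚ) (f : A → ℚ) xs → 𝔼 (map (λ x → q , x) xs) f ≡ q * ΣL f xs
𝔼-map q f []       = sym (ℚ.*-zeroʳ q)
𝔼-map q f (x ∷ xs) = trans (cong (_+_ (q * f x)) (𝔼-map q f xs)) (sym (ℚ.*-distribˡ-+ q (f x) (ΣL f xs)))

-- For `[]` both sides are 0, again because `inv 0` is 0.
𝔼-uniform : ∀ (f : A → ℚ) xs → 𝔼 (uniform xs) f ≡ inv (length xs) * ΣL f xs
𝔼-uniform f []          = refl
𝔼-uniform f xs@(_ ∷ _) = 𝔼-map (inv (length xs)) f xs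

𝔼-++ : ∀ (d e : Dist A) f → 𝔼 (d ++ e) f ≡ 𝔼 d f + 𝔼 e f
𝔼-++ []            e f = sym (ℚ.+-identityˡ (𝔼 e f))
𝔼-++ ((p , x) ∷ d) e f = trans (cong (_+_ (p * f x)) (𝔼-++ d e f)) (sym (ℚ.+-assoc (p * f x) (𝔼 d f) (𝔼 e f)))

𝔼-scale : ∀ p (d : Dist A) f → 𝔼 (map (λ (q , y) → p * q , y) d) f ≡ p * 𝔼 d f
𝔼-scale p []            f = sym (ℚ.*-zeroʳ p)
𝔼-scale p ((q , y) ∷ d) f = trans (cong (_+_ (p * q * f y)) (𝔼-scale p d f))
  (solve 4 (λ p q y r → p :* q :* y :+ p :* r := p :* (q :* y :+ r)) refl p q (f y) (𝔼 d f))

𝔼->>= : ∀ (d : Dist A) (g : A → Dist B) f → 𝔼 (d >>= g) f ≡ 𝔼 d (λ x → 𝔼 (g x) f)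
𝔼->>= []            g f = refl
𝔼->>= ((p , x) ∷ d) g f = trans (𝔼-++ (map (λ (q , y) → p * q , y) (g x)) (d >>= g) f)
  (cong₂ _+_ (𝔼-scale p (g x) f) (𝔼->>= d g f))

filter-map : ∀ {P : B → Set} (P? : Decidable P) (f : A → B) xs →
             filter P? (map f xs) ≡ map f (filter (P? ∘ f) xs)
filter-map P? f []       = refl
filter-map P? f (x ∷ xs) with does (P? (f x))
... | true  = cong (f x ∷_) (filter-map P? f xs)
... | false = filter-map P? f xs

-- The paths from S to 0 as bare step sequences: without the starting height, a longer path is a
-- shorter one with a step consed on.
hits : ∀ n S → List (Vec Step n)
hits n S = filter (λ v → endHeight (S , v) ℤ.≟ 0ℤ) (stepSequences n)

hits-suc : ∀ n S → hits (suc n) S ≡ map (up ∷_) (hits n (move up S)) ++ map (down ∷_) (hits n (move down S))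
hits-suc n S = trans
  (List.filter-++ (λ v → endHeight (S , v) ℤ.≟ 0ℤ) (map (up ∷_) (stepSequences n)) (map (down ∷_) (stepSequences n)))
  (cong₂ _++_ (filter-map _ (up ∷_) (stepSequences n)) (filter-map _ (down ∷_) (stepSequences n)))

pathsFrom≡ : ∀ n S → pathsFrom n S ≡ map (S ,_) (hits n S)
pathsFrom≡ n S = filter-map (λ P → endHeight P ℤ.≟ 0ℤ) (S ,_) (stepSequences n)

-- The index j is the number of down steps on every path from this height to 0. Hence a first step
-- up keeps j and a first step down lowers it by one.
start : ℕ → ℕ → ℤ
start n j = + (2 ℕ.* j) ℤ.- + n

move-up-start : ∀ n j → move up (start (suc n) j) ≡ start n j
move-up-start n j = ℤ-Solver.solve 2
  (λ x y → (x ℤ-Solver.:- (ℤ-Solver.con ℤ.1ℤ ℤ-Solver.:+ y)) ℤ-Solver.:+ ℤ-Solver.con ℤ.1ℤ ℤ-Solver.:= x ℤ-Solver.:- y) refl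
  (+ (2 ℕ.* j)) (+ n)

move-down-start : ∀ n j → move down (start (suc n) (suc j)) ≡ start n j
move-down-start n j = trans (cong (λ z → move down (+ z ℤ.- + suc n)) (ℕ.*-suc 2 j))
  (ℤ-Solver.solve 2
    (λ x y → ((ℤ-Solver.con (+ 2) ℤ-Solver.:+ x) ℤ-Solver.:- (ℤ-Solver.con ℤ.1ℤ ℤ-Solver.:+ y)) ℤ-Solver.:- ℤ-Solver.con ℤ.1ℤ
           ℤ-Solver.:= x ℤ-Solver.:- y) refl
    (+ (2 ℕ.* j)) (+ n))

-- The height is -(n + 2 + m), too low for n steps. The slack m carries the induction: an up step
-- keeps it and a down step raises it by 2.
hits-below : ∀ n m → hits n (ℤ.-[1+ suc n ℕ.+ m ]) ≡ []
hits-below zero    m = refl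
hits-below (suc n) m = trans (hits-suc n ℤ.-[1+ suc (suc n) ℕ.+ m ])
  (cong₂ (λ u v → map (up ∷_) u ++ map (down ∷_) v) (hits-below n m)
    (trans (cong (λ z → hits n ℤ.-[1+ suc z ]) (lem n m)) (hits-below n (2 ℕ.+ m))))
  where
  lem : ∀ n m → suc (suc (n ℕ.+ m) ℕ.+ 0) ≡ n ℕ.+ (2 ℕ.+ m)
  lem = ℕ-Tactic.solve-∀

hits-down-0 : ∀ n → hits n (move down (start (suc n) 0)) ≡ []
hits-down-0 n = hits-below n 0

#hits-suc : ∀ n S → length (hits (suc n) S) ≡ length (hits n (move up S)) ℕ.+ length (hits n (move down S))
#hits-suc n S = trans (cong length (hits-suc n S))
  (trans (List.length-++ (map (up ∷_) (hits n (move up S))))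
         (cong₂ ℕ._+_ (List.length-map (up ∷_) (hits n (move up S))) (List.length-map (down ∷_) (hits n (move down S)))))

-- Splitting by the first step gives Pascal's rule.
#hits : ∀ n j → length (hits n (start n j)) ≡ n C j
#hits zero    zero    = refl
#hits zero    (suc j) = sym (k>n⇒nCk≡0 {0} {suc j} (s≤s z≤n))
#hits (suc n) zero    = trans (#hits-suc n (start (suc n) 0))
  (trans (cong₂ (λ u v → length (hits n u) ℕ.+ length v) (move-up-start n 0) (hits-down-0 n))
  (trans (ℕ.+-identityʳ _) (trans (#hits n 0) (trans (nC0≡1 n) (sym (nC0≡1 (suc n)))))))
#hits (suc n) (suc j) = trans (#hits-suc n (start (suc n) (suc j)))
  (trans (cong₂ (λ u v → length (hits n u) ℕ.+ length (hits n v)) (move-up-start n (suc j)) (move-down-start n j))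
  (trans (cong₂ ℕ._+_ (#hits n (suc j)) (#hits n j))
  (trans (ℕ.+-comm (n C suc j) (n C j)) (nCk+nC[k+1]≡[n+1]C[k+1] n j))))

totalZeros : ℕ → ℤ → ℚ
totalZeros n S = ΣL (λ v → ι (zeros (S , v))) (hits n S)

zeros-∷ : ∀ {n} S s (v : Vec Step n) → ι (zeros (S , s ∷ v)) ≡ ι [ S ℤ.≟ 0ℤ ] + ι (zeros (move s S , v))
zeros-∷ S s v with S ℤ.≟ 0ℤ
... | yes _ = trans (ι-suc k) (ℚ.+-comm (ι k) 1ℚ)
  where k = zeros (move s S , v)
... | no  _ = sym (ℚ.+-identityˡ (ι (zeros (move s S , v))))

-- Each path contributes its starting point, hence the factor counting the paths, and the zeros of
-- what remains after the first step.
totalZeros-suc : ∀ n S → totalZeros (suc n) S ≡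
  ι [ S ℤ.≟ 0ℤ ] * ι (length (hits (suc n) S)) + (totalZeros n (move up S) + totalZeros n (move down S))
totalZeros-suc n S = begin
  ΣL z (hits (suc n) S)                          ≡⟨ cong (ΣL z) (hits-suc n S) ⟩
  ΣL z (map (up ∷_) U ++ map (down ∷_) D)        ≡⟨ ΣL-++ z (map (up ∷_) U) (map (down ∷_) D) ⟩
  ΣL z (map (up ∷_) U) + ΣL z (map (down ∷_) D)  ≡⟨ cong₂ _+_ (part up U) (part down D) ⟩
  (i * ι (length U) + ΣL (z′ up) U) + (i * ι (length D) + ΣL (z′ down) D)
    ≡⟨ solve 5 (λ i u d x y → (i :* u :+ x) :+ (i :* d :+ y) := i :* (u :+ d) :+ (x :+ y)) refl
         i (ι (length U)) (ι (length D)) (ΣL (z′ up) U) (ΣL (z′ down) D) ⟩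
  i * (ι (length U) + ι (length D)) + (ΣL (z′ up) U + ΣL (z′ down) D)
    ≡⟨ cong (λ x → i * x + (ΣL (z′ up) U + ΣL (z′ down) D)) (trans (sym (ι-+ (length U) (length D))) (cong ι (sym (#hits-suc n S)))) ⟩
  i * ι (length (hits (suc n) S)) + (ΣL (z′ up) U + ΣL (z′ down) D) ∎
  where
  open ≡-Reasoning
  i = ι [ S ℤ.≟ 0ℤ ]
  U = hits n (move up S)
  D = hits n (move down S)
  z : Vec Step (suc n) → ℚ
  z v = ι (zeros (S , v))
  z′ : Step → Vec Step n → ℚ
  z′ s v = ι (zeros (move s S , v))
  part : ∀ s xs → ΣL z (map (s ∷_) xs) ≡ i * ι (length xs) + ΣL (z′ s) xs
  part s xs = trans (ΣL-map z (s ∷_) xs) (trans (ΣL-cong (zeros-∷ S s) xs) (ΣL-const+ i (z′ s) xs))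

totalZeros-empty : ∀ n S → length (hits n S) ≡ 0 → totalZeros n S ≡ 0ℚ
totalZeros-empty n S e with hits n S
... | [] = refl

-- For j ≤ n this is C(n,j) times the expected number of zeros given the starting height.
τ : ℕ → ℕ → ℚ
τ n j = totalZeros n (start n j)

shifted : ℕ → ℕ → ℚ
-- This case stands for the starting height -2 - n, from which 0 is out of reach.
shifted n zero    = 0ℚ
shifted n (suc j) = τ n j

τ-suc : ∀ n j → τ (suc n) j ≡ ι [ start (suc n) j ℤ.≟ 0ℤ ] * ι (suc n C j) + (τ n j + shifted n j)
τ-suc n j = trans (totalZeros-suc n (start (suc n) j))
  (cong₂ _+_ (cong (λ z → ι [ start (suc n) j ℤ.≟ 0ℤ ] * ι z) (#hits (suc n) j))
    (cong₂ _+_ (cong (totalZeros n) (move-up-start n j)) (last j)))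
  where
  last : ∀ j → totalZeros n (move down (start (suc n) j)) ≡ shifted n j
  last zero    = totalZeros-empty n _ (cong length (hits-down-0 n))
  last (suc j) = cong (totalZeros n) (move-down-start n j)

τ-beyond : ∀ n → τ n (suc n) ≡ 0ℚ
τ-beyond n = totalZeros-empty n _ (trans (#hits n (suc n)) (k>n⇒nCk≡0 {n} {suc n} ℕ.≤-refl))

-- Condition on the starting height; the j-th one has C(n,j) equally likely paths.
𝔼Z≡ : ∀ n → 𝔼Z n ≡ inv (suc n) * Σ< (suc n) (λ j → inv (n C j) * τ n j)
𝔼Z≡ n = begin
  𝔼 (uniform (startingHeights n) >>= (λ S → uniform (pathsFrom n S))) z
    ≡⟨ 𝔼->>= (uniform (startingHeights n)) (λ S → uniform (pathsFrom n S)) z ⟩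
  𝔼 (uniform (startingHeights n)) inner
    ≡⟨ 𝔼-uniform inner (startingHeights n) ⟩
  inv (length (startingHeights n)) * ΣL inner (startingHeights n)
    ≡⟨ cong₂ (λ l s → inv l * s)
         (trans (List.length-map (start n) (upTo (suc n))) (List.length-upTo (suc n)))
         (trans (ΣL-map inner (start n) (upTo (suc n))) (ΣL-applyUpTo (inner ∘ start n) (λ j → j) (suc n))) ⟩
  inv (suc n) * Σ< (suc n) (inner ∘ start n)
    ≡⟨ cong (inv (suc n) *_) (Σ-cong (suc n) step) ⟩
  inv (suc n) * Σ< (suc n) (λ j → inv (n C j) * τ n j) ∎
  where
  open ≡-Reasoning
  z : Path n → ℚ
  z P = ι (zeros P)
  inner : ℤ → ℚ
  inner S = 𝔼 (uniform (pathsFrom n S)) z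
  step : ∀ j → inner (start n j) ≡ inv (n C j) * τ n j
  step j = trans (𝔼-uniform z (pathsFrom n (start n j)))
    (trans (cong (λ xs → inv (length xs) * ΣL z xs) (pathsFrom≡ n (start n j)))
    (cong₂ (λ l s → inv l * s)
      (trans (List.length-map (start n j ,_) (hits n (start n j))) (#hits n j))
      (ΣL-map z (start n j ,_) (hits n (start n j)))))

-- After `τ-suc` the indicator of starting at 0 has weight 1. In the rest, each `τ n j` occurs once
-- after an up step and once after a down step, and `inv-weights` merges the two weights into that
-- of length n.
𝔼Z-suc : ∀ n → 𝔼Z (suc n) ≡
  𝔼Z n + Σ< (suc (suc n)) (λ j → ι [ start (suc n) j ℤ.≟ 0ℤ ]) * inv (suc (suc n))
𝔼Z-suc n = begin
  𝔼Z (suc n)                                    ≡⟨ 𝔼Z≡ (suc n) ⟩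
  r * Σ< N (λ j → w j * τ (suc n) j)            ≡⟨ cong (r *_) (Σ-cong< N split) ⟩
  r * Σ< N (λ j → i j + (w j * τ n j + w j * shifted n j))
    ≡⟨ cong (r *_) (trans (Σ-+ N i (λ j → w j * τ n j + w j * shifted n j))
         (cong (_+_ (Σ< N i)) (Σ-+ N (λ j → w j * τ n j) (λ j → w j * shifted n j)))) ⟩
  r * (Σ< N i + (Σ< N (λ j → w j * τ n j) + Σ< N (λ j → w j * shifted n j)))
    -- Both sums reduce to j ≤ n: the last term of one and the first term of the other vanish, as
    -- these heights cannot reach 0 in n steps.
    ≡⟨ cong₂ (λ u v → r * (Σ< N i + (u + v))) drop-last drop-first ⟩
  r * (Σ< N i + (Σ< (suc n) (λ j → w j * τ n j) + Σ< (suc n) (λ j → w (suc j) * τ n j)))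
    ≡⟨ cong (λ z → r * (Σ< N i + z)) (sym (Σ-+ (suc n) (λ j → w j * τ n j) (λ j → w (suc j) * τ n j))) ⟩
  r * (Σ< N i + Σ< (suc n) (λ j → w j * τ n j + w (suc j) * τ n j))
    ≡⟨ solve 3 (λ r x y → r :* (x :+ y) := r :* y :+ x :* r) refl r (Σ< N i) (Σ< (suc n) (λ j → w j * τ n j + w (suc j) * τ n j)) ⟩
  r * Σ< (suc n) (λ j → w j * τ n j + w (suc j) * τ n j) + Σ< N i * r
    ≡⟨ cong (_+ Σ< N i * r) (begin
         r * Σ< (suc n) (λ j → w j * τ n j + w (suc j) * τ n j)
           ≡⟨ Σ-*ˡ (suc n) r (λ j → w j * τ n j + w (suc j) * τ n j) ⟩
         Σ< (suc n) (λ j → r * (w j * τ n j + w (suc j) * τ n j))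
           ≡⟨ Σ-cong< (suc n) merge ⟩
         Σ< (suc n) (λ j → inv (suc n) * (inv (n C j) * τ n j))
           ≡⟨ sym (Σ-*ˡ (suc n) (inv (suc n)) (λ j → inv (n C j) * τ n j)) ⟩
         inv (suc n) * Σ< (suc n) (λ j → inv (n C j) * τ n j)
           ≡⟨ sym (𝔼Z≡ n) ⟩
         𝔼Z n ∎) ⟩
  𝔼Z n + Σ< N i * r ∎
  where
  open ≡-Reasoning
  N = suc (suc n)
  r = inv N
  w : ℕ → ℚ
  w j = inv (suc n C j)
  i : ℕ → ℚ
  i j = ι [ start (suc n) j ℤ.≟ 0ℤ ]
  split : ∀ j → j ℕ.< N → w j * τ (suc n) j ≡ i j + (w j * τ n j + w j * shifted n j)
  split j (s≤s j≤) = trans (cong (w j *_) (τ-suc n j))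
    (trans (solve 5 (λ w i c x y → w :* (i :* c :+ (x :+ y)) := i :* (c :* w) :+ (w :* x :+ w :* y)) refl
             (w j) (i j) (ι (suc n C j)) (τ n j) (shifted n j))
    (cong (_+ (w j * τ n j + w j * shifted n j))
      (trans (cong (i j *_) (ι*inv≡1′ (suc n C j) (C-pos (suc n) j j≤))) (ℚ.*-identityʳ (i j)))))
  drop-last : Σ< N (λ j → w j * τ n j) ≡ Σ< (suc n) (λ j → w j * τ n j)
  drop-last = trans (cong (λ z → Σ< (suc n) (λ j → w j * τ n j) + w (suc n) * z) (τ-beyond n))
    (trans (cong (_+_ (Σ< (suc n) (λ j → w j * τ n j))) (ℚ.*-zeroʳ (w (suc n)))) (ℚ.+-identityʳ _))
  drop-first : Σ< N (λ j → w j * shifted n j) ≡ Σ< (suc n) (λ j → w (suc j) * τ n j)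
  drop-first = trans (Σ-head (suc n) (λ j → w j * shifted n j))
    (trans (cong (_+ Σ< (suc n) (λ j → w (suc j) * τ n j)) (ℚ.*-zeroʳ (w 0))) (ℚ.+-identityˡ _))
  merge : ∀ j → j ℕ.< suc n → r * (w j * τ n j + w (suc j) * τ n j) ≡ inv (suc n) * (inv (n C j) * τ n j)
  merge j (s≤s j≤n) = trans
    (solve 4 (λ r a b t → r :* (a :* t :+ b :* t) := r :* (a :+ b) :* t) refl r (w j) (w (suc j)) (τ n j))
    (trans (cong (_* τ n j) (inv-weights n j j≤n)) (ℚ.*-assoc (inv (suc n)) (inv (n C j)) (τ n j)))

-- Parity of the starting height and the closed form of the expectation

[]-true : ∀ {P : Set} (P? : Dec P) → P → [ P? ] ≡ 1
[]-true (yes _) _ = refl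
[]-true (no ¬p) p = contradiction p ¬p

[]-false : ∀ {P : Set} (P? : Dec P) → ¬ P → [ P? ] ≡ 0
[]-false (yes p) ¬p = contradiction p ¬p
[]-false (no _)  _  = refl

Σ-zero : ∀ n {f} → (∀ j → j ℕ.< n → f j ≡ 0ℚ) → Σ< n f ≡ 0ℚ
Σ-zero n e = trans (Σ-cong< n e) (trans (Σ-const n 0ℚ) (ℚ.*-zeroʳ (ι n)))

start≡0⇒ : ∀ n j → start n j ≡ 0ℤ → j ℕ.* 2 ≡ n
start≡0⇒ n j e = trans (ℕ.*-comm j 2) (ℤ.+-injective (ℤ.i-j≡0⇒i≡j (+ (2 ℕ.* j)) (+ n) e))

start≡0 : ∀ m → start (m ℕ.* 2) m ≡ 0ℤ
start≡0 m = trans (cong (λ z → + z ℤ.- + (m ℕ.* 2)) (ℕ.*-comm 2 m)) (ℤ.+-inverseʳ (+ (m ℕ.* 2)))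

Σ-start-even : ∀ m → Σ< (suc (m ℕ.* 2)) (λ j → ι [ start (m ℕ.* 2) j ℤ.≟ 0ℤ ]) ≡ 1ℚ
Σ-start-even m = begin
  -- Writing 2m + 1 as (m + 1) + m makes the only nonzero term, j = m, the last one of the first
  -- block.
  Σ< (suc (m ℕ.* 2)) f      ≡⟨ cong (λ z → Σ< z f) (lem m) ⟩
  Σ< (suc m ℕ.+ m) f        ≡⟨ Σ-split (suc m) m f ⟩
  Σ< m f + f m + Σ< m (λ j → f (suc m ℕ.+ j))
    ≡⟨ cong₂ _+_ (cong₂ _+_ (Σ-zero m (λ j j<m → off j (ℕ.<⇒≢ j<m))) (cong ι ([]-true (start (m ℕ.* 2) m ℤ.≟ 0ℤ) (start≡0 m))))
                 (Σ-zero m (λ j _ → off (suc m ℕ.+ j) (≢-sym (ℕ.<⇒≢ (s≤s (ℕ.m≤m+n m j)))))) ⟩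
  0ℚ + 1ℚ + 0ℚ ∎
  where
  open ≡-Reasoning
  f : ℕ → ℚ
  f j = ι [ start (m ℕ.* 2) j ℤ.≟ 0ℤ ]
  lem : ∀ m → suc (m ℕ.* 2) ≡ suc m ℕ.+ m
  lem = ℕ-Tactic.solve-∀
  off : ∀ j → j ≢ m → f j ≡ 0ℚ
  off j j≢m = cong ι ([]-false (start (m ℕ.* 2) j ℤ.≟ 0ℤ) (λ e → j≢m (ℕ.*-cancelʳ-≡ j m 2 (start≡0⇒ (m ℕ.* 2) j e))))

odd≢even : ∀ m j → j ℕ.* 2 ≢ suc (m ℕ.* 2)
odd≢even m j e = ℕ.even≢odd j m (trans (ℕ.*-comm 2 j) (trans e (cong suc (ℕ.*-comm m 2))))

Σ-start-odd : ∀ m k → Σ< k (λ j → ι [ start (suc (m ℕ.* 2)) j ℤ.≟ 0ℤ ]) ≡ 0ℚ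
Σ-start-odd m k = Σ-zero k λ j _ → cong ι ([]-false (start (suc (m ℕ.* 2)) j ℤ.≟ 0ℤ)
  (λ e → odd≢even m j (start≡0⇒ (suc (m ℕ.* 2)) j e)))

-- Paths of odd length that end at 0 start at odd heights, so the additional point is never a zero.
𝔼Z-odd : ∀ m → 𝔼Z (suc (m ℕ.* 2)) ≡ 𝔼Z (m ℕ.* 2)
𝔼Z-odd m = trans (𝔼Z-suc (m ℕ.* 2))
  (trans (cong (λ z → 𝔼Z (m ℕ.* 2) + z * inv (suc (suc (m ℕ.* 2)))) (Σ-start-odd m (suc (suc (m ℕ.* 2)))))
  (trans (cong (_+_ (𝔼Z (m ℕ.* 2))) (ℚ.*-zeroˡ (inv (suc (suc (m ℕ.* 2)))))) (ℚ.+-identityʳ _)))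

-- From m to m + 1 the expectation grows by 1/(2m + 3). The right-hand side grows by the same
-- amount, since 1/(2m + 2) cancels against half of 1/(m + 1).
𝔼Z-even : ∀ m → 𝔼Z (m ℕ.* 2) ≡ harmonic (suc (m ℕ.* 2)) - ½ * harmonic m
𝔼Z-even zero    = refl
𝔼Z-even (suc m) = begin
  𝔼Z (suc (suc k))                         ≡⟨ 𝔼Z-suc (suc k) ⟩
  𝔼Z (suc k) + Σ< (suc (suc (suc k))) (λ j → ι [ start (suc (suc k)) j ℤ.≟ 0ℤ ]) * c
    ≡⟨ cong₂ (λ u v → u + v * c) (trans (𝔼Z-odd m) (𝔼Z-even m)) (Σ-start-even (suc m)) ⟩
  harmonic (suc k) - ½ * harmonic m + 1ℚ * c
    ≡⟨ solve 4 (λ x y b c → x :- con ½ :* y :+ con 1ℚ :* c := x :+ b :* con ½ :+ c :- con ½ :* (y :+ b)) refl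
         (harmonic (suc k)) (harmonic m) (inv (suc m)) c ⟩
  harmonic (suc k) + inv (suc m) * ½ + c - ½ * (harmonic m + inv (suc m))
    ≡⟨ cong (λ z → harmonic (suc k) + z + c - ½ * (harmonic m + inv (suc m))) (sym (inv-* (suc m) 2)) ⟩
  harmonic (suc k) + inv (suc (suc k)) + c - ½ * (harmonic m + inv (suc m)) ∎
  where
  open ≡-Reasoning
  k = m ℕ.* 2
  c = inv (suc (suc (suc k)))

-- Riemann sums of the logarithm over one unit

⅓ ¼ ⅟₁₂ : ℚ
⅓ = + 1 / 3
¼ = + 1 / 4
⅟₁₂ = + 1 / 12

-- Reduces an inequality to an identity with an explicit nonnegative difference.
0≤-diff : ∀ {p q} r → 0ℚ ≤ r → q ≡ p + r → p ≤ q
0≤-diff {p} r 0≤r e = subst (p ≤_) (sym e) (p≤p+q p 0≤r)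

-- Equality modulo a relation e = 0: with the cofactor q written out, the ring solver can check it.
modulo : ∀ {x y e} q → e ≡ 0ℚ → x ≡ y + q * e → x ≡ y
modulo {x} {y} q refl eq = trans eq (trans (cong (_+_ y) (ℚ.*-zeroʳ q)) (ℚ.+-identityʳ y))

-- The fourth Taylor polynomial of log (1 + w).
logTaylor : ℚ → ℚ
logTaylor w = w - ½ * (w * w) + ⅓ * (w * w * w) - ¼ * (w * w * w * w)

-- In the application η = 1/M, w = ℓ/M and v = 1/(M + ℓ), the sample term of the Riemann sum at 1 +
-- w.
module _ {v w η B : ℚ} (v-eq : v + v * w ≡ η) (0≤v : 0ℚ ≤ v) (0≤w : 0ℚ ≤ w)
         (0≤η : 0ℚ ≤ η) (η≤1 : η ≤ 1ℚ) (w≤B : w ≤ B) (B≤1 : B ≤ 1ℚ) where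

  private
    -- Times η², this is the part of `logTaylor (w + η) - logTaylor w` of order at least 2 in η.
    curvature : ℚ
    curvature = - ½ + w + ⅓ * η - ((1ℚ + ½) * (w * w) + w * η + ¼ * (η * η))

  -- (1 + w)⁻¹ = 1 - w + w² - w³ + w⁴ (1 + w)⁻¹, and v = η (1 + w)⁻¹.
  taylor-increment : v - (logTaylor (w + η) - logTaylor w) ≡ v * (w * w * w * w) - η * η * curvature
  taylor-increment = modulo {e = v + v * w - η} (1ℚ - w + w * w - w * w * w)
    (trans (cong (_- η) v-eq) (ℚ.+-inverseʳ η))
    (solve 3 (λ v w η →
      let P = λ w → w :- con ½ :* (w :* w) :+ con ⅓ :* (w :* w :* w) :- con ¼ :* (w :* w :* w :* w)
      in v :- (P (w :+ η) :- P w)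
         := v :* (w :* w :* w :* w)
            :- η :* η :* (con (- ½) :+ w :+ con ⅓ :* η
               :- ((con (1ℚ + ½)) :* (w :* w) :+ w :* η :+ con ¼ :* (η :* η)))
            :+ (con 1ℚ :- w :+ w :* w :- w :* w :* w) :* (v :+ v :* w :- η)) refl v w η)

  taylor-increment-≤ : ∣ v - (logTaylor (w + η) - logTaylor w) ∣ ≤ η * (B * B * B * B) + η * η * (+ 5 / 1)
  taylor-increment-≤ = subst (λ z → ∣ z ∣ ≤ η * (B * B * B * B) + η * η * (+ 5 / 1)) (sym taylor-increment)
    (∣-∣≤ (∣*∣≤ ∣v∣ (∣*∣≤ (∣*∣≤ (∣*∣≤ ∣w∣ ∣w∣) ∣w∣) ∣w∣))
          (∣*∣≤ (∣*∣≤ ∣η∣ ∣η∣) ∣curvature∣))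
    where
    ∣v∣ : ∣ v ∣ ≤ η
    ∣v∣ = 0≤p≤c⇒∣p∣≤c 0≤v (subst (v ≤_) v-eq (p≤p+q v (0≤* 0≤v 0≤w)))
    ∣w∣ : ∣ w ∣ ≤ B
    ∣w∣ = 0≤p≤c⇒∣p∣≤c 0≤w w≤B
    ∣η∣ : ∣ η ∣ ≤ η
    ∣η∣ = 0≤p≤c⇒∣p∣≤c 0≤η ℚ.≤-refl
    w₁ : ∣ w ∣ ≤ 1ℚ
    w₁ = ℚ.≤-trans ∣w∣ B≤1
    η₁ : ∣ η ∣ ≤ 1ℚ
    η₁ = ℚ.≤-trans ∣η∣ η≤1
    ∣curvature∣ : ∣ curvature ∣ ≤ + 5 / 1
    ∣curvature∣ = ℚ.≤-trans
      (∣-∣≤ (∣+∣≤ (∣+∣≤ {d = 1ℚ} (ℚ.≤-refl {∣ - ½ ∣}) w₁) (∣*∣≤ (ℚ.≤-refl {∣ ⅓ ∣}) η₁))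
            (∣+∣≤ (∣+∣≤ (∣*∣≤ (ℚ.≤-refl {∣ 1ℚ + ½ ∣}) (∣*∣≤ w₁ w₁)) (∣*∣≤ w₁ η₁))
                  (∣*∣≤ (ℚ.≤-refl {∣ ¼ ∣}) (∣*∣≤ η₁ η₁))))
      -- The absolute coefficients of `curvature` add up to 55/12 = 5 - 5/12.
      (0≤-diff (+ 5 / 12) (ℚ.nonNegative⁻¹ (+ 5 / 12)) refl)

-- Sums the ℓ increments. The bound m stays fixed in the induction, so that w ≤ B is available at
-- each of them.
block-taylor : ∀ M B ℓ m → B ≤ 1ℚ → ι m * inv (suc M) ≤ B → ℓ ℕ.≤ m →
  ∣ h (suc M) ℓ - logTaylor (ι ℓ * inv (suc M)) ∣
    ≤ ι ℓ * (inv (suc M) * (B * B * B * B) + inv (suc M) * inv (suc M) * (+ 5 / 1))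
block-taylor M B zero m B≤1 mη≤B _ = ℚ.≤-reflexive
  (trans (cong (λ z → ∣ 0ℚ - logTaylor z ∣) (ℚ.*-zeroˡ (inv (suc M)))) (sym (ℚ.*-zeroˡ (η * (B * B * B * B) + η * η * (+ 5 / 1)))))
  where η = inv (suc M)
block-taylor M B (suc ℓ) m B≤1 mη≤B ℓ<m = subst₂ (λ u v → ∣ u ∣ ≤ v)
  (trans (solve 4 (λ s v p q → (s :- p) :+ (v :- (q :- p)) := (s :+ v) :- q) refl
           (h (suc M) ℓ) v (logTaylor w) (logTaylor (w + η)))
         (cong (λ z → h (suc M) (suc ℓ) - logTaylor z) w+η))
  (trans (solve 2 (λ x k → x :* k :+ k := (x :+ con 1ℚ) :* k) refl (ι ℓ) K) (cong (_* K) (sym (ι-suc ℓ))))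
  (∣+∣≤ (block-taylor M B ℓ m B≤1 mη≤B (ℕ.<⇒≤ ℓ<m))
        (taylor-increment-≤ v-eq (inv-nonNeg (suc M ℕ.+ ℓ)) (0≤* (ι-nonNeg ℓ) 0≤η) 0≤η (inv≤1 (suc M)) w≤B B≤1))
  where
  η = inv (suc M)
  w = ι ℓ * η
  v = inv (suc M ℕ.+ ℓ)
  K = η * (B * B * B * B) + η * η * (+ 5 / 1)
  0≤η = inv-nonNeg (suc M)
  w+η : w + η ≡ ι (suc ℓ) * η
  w+η = trans (solve 2 (λ x η → x :* η :+ η := (x :+ con 1ℚ) :* η) refl (ι ℓ) η) (cong (_* η) (sym (ι-suc ℓ)))
  w≤B : w ≤ B
  w≤B = ℚ.≤-trans (*-mono-≤-nonNeg (ι-nonNeg ℓ) 0≤η (ι-mono (ℕ.<⇒≤ ℓ<m)) ℚ.≤-refl) mη≤B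
  v-eq : v + v * w ≡ η
  v-eq = trans (cong (λ z → z + v * w) (trans (sym (ℚ.*-identityʳ v)) (cong (v *_) (sym (ι*inv≡1 M)))))
    (trans (solve 4 (λ v a η l → v :* (a :* η) :+ v :* (l :* η) := ((a :+ l) :* v) :* η) refl v (ι (suc M)) η (ι ℓ))
    (trans (cong (λ z → z * v * η) (sym (ι-+ (suc M) ℓ)))
    (trans (cong (_* η) (ι*inv≡1 (M ℕ.+ ℓ))) (ℚ.*-identityˡ η))))

-- The Riemann sum over [x , x + 1] for x = y + 1, where w runs up to a = 1/x. The term a⁵ is the
-- Taylor error and the other one the error of the mesh.
unit-block : ∀ y k → let a = inv (suc y) in
  ∣ h (suc y ℕ.* suc k) (suc k) - logTaylor a ∣ ≤ a * a * a * a * a + inv (suc k) * (+ 5 / 1)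
unit-block y k = ℚ.≤-trans
  (subst (λ z → ∣ h M m - logTaylor z ∣ ≤ ι m * (η * (a * a * a * a) + η * η * (+ 5 / 1))) mη≡a
    (block-taylor (k ℕ.+ y ℕ.* m) a m m (inv≤1 (suc y)) (ℚ.≤-reflexive mη≡a) ℕ.≤-refl))
  (ℚ.≤-trans
    (ℚ.≤-reflexive (trans
      (solve 4 (λ m η a c → m :* (η :* (a :* a :* a :* a) :+ η :* η :* c)
                := (m :* η) :* (a :* a :* a :* a) :+ (m :* η) :* η :* c) refl (ι m) η a (+ 5 / 1))
      (trans (cong (λ z → z * (a * a * a * a) + z * η * (+ 5 / 1)) mη≡a)
      (solve 3 (λ a η c → a :* (a :* a :* a :* a) :+ a :* η :* c := a :* a :* a :* a :* a :+ a :* η :* c) refl a η (+ 5 / 1)))))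
    (ℚ.+-monoʳ-≤ (a * a * a * a * a) (*-mono-≤-nonNeg (0≤* 0≤a 0≤η) (ℚ.nonNegative⁻¹ (+ 5 / 1))
      (subst (a * η ≤_) (ℚ.*-identityˡ (inv m)) (*-mono-≤-nonNeg 0≤a 0≤η (inv≤1 (suc y)) η≤invm)) ℚ.≤-refl)))
  where
  m = suc k
  M = suc y ℕ.* m
  a = inv (suc y)
  η = inv M
  0≤a = inv-nonNeg (suc y)
  0≤η = inv-nonNeg M
  mη≡a : ι m * η ≡ a
  mη≡a = ι*inv y k
  η≤invm : η ≤ inv m
  η≤invm = inv-anti k (k ℕ.+ y ℕ.* m) (ℕ.m≤m+n k (y ℕ.* m))

-- At a = 1/x these are the terms 1/(2x) - 1/(12x²) of the expansion of H_x.
corr : ℚ → ℚ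
corr a = ½ * a - ⅟₁₂ * (a * a)

-- log (x + 1) - log x is approximated by the trapezoidal rule with its first
-- Euler–Maclaurin correction, which is the left-hand side below.
module _ {a b : ℚ} (a-b : b ≡ a - a * b) (0≤b : 0ℚ ≤ b) (b≤a : b ≤ a) (a≤1 : a ≤ 1ℚ) where

  private
    0≤a : 0ℚ ≤ a
    0≤a = ℚ.≤-trans 0≤b b≤a

    rel : a - b - a * b ≡ 0ℚ
    rel = trans (solve 2 (λ a b → a :- b :- a :* b := (a :- a :* b) :- b) refl a b)
      (trans (cong (_- b) (sym a-b)) (ℚ.+-inverseʳ b))

    Q : ℚ
    Q = - ¼ * (a * a * a * b) + ¼ * (a * a * a) - ⅟₁₂ * (a * a * b) - ⅓ * (a * a) + ⅟₁₂ * (a * b)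
        + (+ 5 / 12) * a - ⅟₁₂ * b - ½

  -- With the cofactor `Q` of `rel`, everything of degree below 5 in a and b cancels.
  corr-taylor : (b - corr b + corr a) - logTaylor a ≡
    ½ * (a * a * a * a * b) - (⅓ * (a * a * a * b * b) + ¼ * (a * a * a * a * b * b))
  corr-taylor = modulo Q rel (solve 2 (λ a b →
    let cr = λ a → con ½ :* a :- con ⅟₁₂ :* (a :* a)
    in (b :- cr b :+ cr a)
       :- (a :- con ½ :* (a :* a) :+ con ⅓ :* (a :* a :* a) :- con ¼ :* (a :* a :* a :* a))
       := con ½ :* (a :* a :* a :* a :* b)
          :- (con ⅓ :* (a :* a :* a :* b :* b) :+ con ¼ :* (a :* a :* a :* a :* b :* b))
          :+ (con (- ¼) :* (a :* a :* a :* b) :+ con ¼ :* (a :* a :* a) :- con ⅟₁₂ :* (a :* a :* b)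
              :- con ⅓ :* (a :* a) :+ con ⅟₁₂ :* (a :* b) :+ con (+ 5 / 12) :* a :- con ⅟₁₂ :* b :- con ½)
             :* (a :- b :- a :* b)) refl a b)

  corr-taylor-≤ : ∣ (b - corr b + corr a) - logTaylor a ∣ ≤ (+ 2 / 1) * (a * a * a * a * a)
  corr-taylor-≤ = subst (λ z → ∣ z ∣ ≤ (+ 2 / 1) * (a * a * a * a * a)) (sym corr-taylor) (ℚ.≤-trans
    (∣-∣≤ (∣*∣≤ (ℚ.≤-refl {∣ ½ ∣}) (∣*∣≤ aaaa ∣b∣))
          (∣+∣≤ (∣*∣≤ (ℚ.≤-refl {∣ ⅓ ∣}) (∣*∣≤ (∣*∣≤ aaa ∣b∣) ∣b∣))
                (∣*∣≤ (ℚ.≤-refl {∣ ¼ ∣}) (∣*∣≤ (∣*∣≤ (∣*∣≤ aaa ∣a∣₁) ∣b∣) ∣b∣))))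
    -- As b ≤ a ≤ 1, the sum is at most (1/2 + 1/3 + 1/4) a⁵ = (2 - 11/12) a⁵.
    (0≤-diff ((+ 11 / 12) * (a * a * a * a * a)) (0≤* (ℚ.nonNegative⁻¹ (+ 11 / 12)) (0≤* (0≤* (0≤* (0≤* 0≤a 0≤a) 0≤a) 0≤a) 0≤a))
      (solve 1 (λ a → con (+ 2 / 1) :* (a :* a :* a :* a :* a)
        := con ½ :* (a :* a :* a :* a :* a)
           :+ (con ⅓ :* (a :* a :* a :* a :* a) :+ con ¼ :* (a :* a :* a :* con 1ℚ :* a :* a))
           :+ con (+ 11 / 12) :* (a :* a :* a :* a :* a)) refl a)))
    where
    ∣a∣ : ∣ a ∣ ≤ a
    ∣a∣ = 0≤p≤c⇒∣p∣≤c 0≤a ℚ.≤-refl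
    ∣a∣₁ : ∣ a ∣ ≤ 1ℚ
    ∣a∣₁ = ℚ.≤-trans ∣a∣ a≤1
    ∣b∣ : ∣ b ∣ ≤ a
    ∣b∣ = 0≤p≤c⇒∣p∣≤c 0≤b b≤a
    aaa : ∣ a * a * a ∣ ≤ a * a * a
    aaa = ∣*∣≤ (∣*∣≤ ∣a∣ ∣a∣) ∣a∣
    aaaa : ∣ a * a * a * a ∣ ≤ a * a * a * a
    aaaa = ∣*∣≤ aaa ∣a∣

  -- Since a - b = a b, the right-hand side is 2 a b (a³ + a² b + a b² + b³), and already 2 a⁴ b =
  -- a⁵ + a⁴ b (1 - a). This turns fifth-power errors into telescoping ones.
  fifth≤fourths : a * a * a * a * a ≤ (+ 2 / 1) * (a * a * a * a - b * b * b * b)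
  fifth≤fourths = 0≤-diff
    (a * a * a * a * b * (1ℚ - a) + (+ 2 / 1) * (a * b * (b * a * a + a * b * b + b * b * b)))
    (0≤+ (0≤* (0≤* (0≤* (0≤* (0≤* 0≤a 0≤a) 0≤a) 0≤a) 0≤b) (≤-sub a≤1))
         (0≤* (ℚ.nonNegative⁻¹ (+ 2 / 1)) (0≤* (0≤* 0≤a 0≤b)
           (0≤+ (0≤+ (0≤* (0≤* 0≤b 0≤a) 0≤a) (0≤* (0≤* 0≤a 0≤b) 0≤b)) (0≤* (0≤* 0≤b 0≤b) 0≤b)))))
    (modulo (- (a * a * a * a) + (+ 2 / 1) * (a * a * a + a * a * b + a * b * b + b * b * b)) rel
      (solve 2 (λ a b → con (+ 2 / 1) :* (a :* a :* a :* a :- b :* b :* b :* b)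
        := a :* a :* a :* a :* a
           :+ (a :* a :* a :* a :* b :* (con 1ℚ :- a)
              :+ con (+ 2 / 1) :* (a :* b :* (b :* a :* a :+ a :* b :* b :+ b :* b :* b)))
           :+ (:- (a :* a :* a :* a) :+ con (+ 2 / 1) :* (a :* a :* a :+ a :* a :* b :+ a :* b :* b :+ b :* b :* b))
              :* (a :- b :- a :* b)) refl a b))

-- Asymptotics of the harmonic numbers

-- For reals x and y, ∣ x -ᴿ y ∣ᴿ ≤ᴿ fromℚ c unfolds to the field of
-- Small c (λ k → seq x k - seq y k).
record Small (c : ℚ) (s : ℕ → ℚ) : Set where
  constructor small
  field
    eventually : ∀ ε → 0ℚ < ε → ∃[ N ] ∀ k → N ℕ.≤ k → ∣ s k ∣ ≤ c + ε

open Small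

Small-+ : ∀ {c d s t} → Small c s → Small d t → Small (c + d) (λ k → s k + t k)
Small-+ {c} {d} {s} {t} p q = small λ ε 0<ε →
  let (M , u) = eventually p (½ * ε) (half-pos 0<ε)
      (N , v) = eventually q (½ * ε) (half-pos 0<ε)
  in M ℕ.⊔ N , λ k l → subst (∣ s k + t k ∣ ≤_)
    (trans (solve 3 (λ c d e → (c :+ e) :+ (d :+ e) := (c :+ d) :+ (e :+ e)) refl c d (½ * ε))
           (cong (_+_ (c + d)) (halves ε)))
    (∣+∣≤ (u k (ℕ.m⊔n≤o⇒m≤o M N l)) (v k (ℕ.m⊔n≤o⇒n≤o M N l)))

-- As ∣ q ∣ ≤ 1, the tolerance ε survives the multiplication unchanged.
Small-* : ∀ {c s} q → ∣ q ∣ ≤ 1ℚ → Small c s → Small (∣ q ∣ * c) (λ k → q * s k)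
Small-* {c} {s} q q≤1 p = small λ ε 0<ε →
  let (N , u) = eventually p ε 0<ε
  in N , λ k l → ℚ.≤-trans (∣*∣≤ (ℚ.≤-refl {∣ q ∣}) (u k l))
    (subst (_≤ ∣ q ∣ * c + ε) (sym (ℚ.*-distribˡ-+ ∣ q ∣ c ε))
      (ℚ.+-monoʳ-≤ (∣ q ∣ * c) (subst (∣ q ∣ * ε ≤_) (ℚ.*-identityˡ ε)
        (*-mono-≤-nonNeg (ℚ.0≤∣p∣ q) (ℚ.<⇒≤ 0<ε) q≤1 ℚ.≤-refl))))

Small-const : ∀ {c p} → ∣ p ∣ ≤ c → Small c (λ _ → p)
Small-const {c} ∣p∣≤c = small λ ε 0<ε → 0 , λ _ _ → ℚ.≤-trans ∣p∣≤c (p≤p+q c (ℚ.<⇒≤ 0<ε))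

Small-resp : ∀ {c s t} → (∀ k → s k ≡ t k) → Small c s → Small c t
Small-resp {c} e p = small λ ε 0<ε → let (N , u) = eventually p ε 0<ε in N , λ k l → subst (λ z → ∣ z ∣ ≤ c + ε) (e k) (u k l)

Small-mono : ∀ {c d s} → c ≤ d → Small c s → Small d s
Small-mono c≤d p = small λ ε 0<ε → let (N , u) = eventually p ε 0<ε in N , λ k l → ℚ.≤-trans (u k l) (ℚ.+-monoˡ-≤ ε c≤d)

Small-closed : ∀ {c s} → (∀ ε → 0ℚ < ε → Small (c + ε) s) → Small c s
Small-closed {c} {s} p = small λ ε 0<ε →
  let (N , u) = eventually (p (½ * ε) (half-pos 0<ε)) (½ * ε) (half-pos 0<ε)
  in N , λ k l → subst (∣ s k ∣ ≤_) (trans (ℚ.+-assoc c (½ * ε) (½ * ε)) (cong (_+_ c) (halves ε))) (u k l)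

Small-inv : ∀ c → Small 0ℚ (λ k → ι c * inv (suc k))
Small-inv c = small λ ε 0<ε →
  -- The tolerance is ε/(c + 1), since c may be 0.
  let (N , u) = archimedean (inv (suc c) * ε) (subst (_< inv (suc c) * ε) (ℚ.*-zeroʳ (inv (suc c)))
                  (ℚ.*-monoʳ-<-pos (inv (suc c)) {{ℚ.positive (inv-pos c)}} 0<ε))
  in N , λ k l → subst (∣ ι c * inv (suc k) ∣ ≤_)
    (trans (sym (ℚ.*-assoc (ι (suc c)) (inv (suc c)) ε)) (trans (cong (_* ε) (ι*inv≡1 c)) (trans (ℚ.*-identityˡ ε) (sym (ℚ.+-identityˡ ε)))))
    (0≤p≤c⇒∣p∣≤c (0≤* (ι-nonNeg c) (inv-nonNeg (suc k)))
      (*-mono-≤-nonNeg (ι-nonNeg c) (inv-nonNeg (suc k)) (ι-mono (ℕ.n≤1+n c)) (u k l)))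

Small-≤ : ∀ {c s} t → (∀ k → ∣ s k ∣ ≤ c + ∣ t k ∣) → Small 0ℚ t → Small c s
Small-≤ {c} t b p = small λ ε 0<ε → let (N , u) = eventually p ε 0<ε in N , λ k l → ℚ.≤-trans (b k)
  (ℚ.+-monoʳ-≤ c (subst (∣ t k ∣ ≤_) (ℚ.+-identityˡ ε) (u k l)))

-- The k-th rational approximation to H_x - c(x) - log x.
gap : ℕ → ℕ → ℚ
gap x k = harmonic x - corr (inv x) - riemannSum x k

riemannSum-suc : ∀ y k → riemannSum (suc (suc y)) k ≡ riemannSum (suc y) k + h (suc y ℕ.* suc k) (suc k)
riemannSum-suc y k = trans (riemannSum≡h (suc (suc y)) k)
  (trans (cong (h (suc k)) (ℕ.+-comm (suc k) (y ℕ.* suc k)))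
  (trans (h-split (suc k) (y ℕ.* suc k) (suc k))
         (cong (_+ h (suc y ℕ.* suc k) (suc k)) (sym (riemannSum≡h (suc y) k)))))

fourth : ℕ → ℚ
fourth x = inv x * inv x * inv x * inv x

0≤fourth : ∀ x → 0ℚ ≤ fourth x
0≤fourth x = 0≤* (0≤* (0≤* p p) p) p
  where p = inv-nonNeg x

-- The increment compares both the corrected trapezoidal rule and the Riemann sum with
-- `logTaylor a`. The errors 2a⁵ and a⁵ add up to 3a⁵, which `fifth≤fourths` bounds by 6(a⁴ - b⁴).
gap-step : ∀ y k → ∣ gap (suc (suc y)) k - gap (suc y) k ∣
                 ≤ (+ 6 / 1) * (fourth (suc y) - fourth (suc (suc y))) + inv (suc k) * (+ 5 / 1)
gap-step y k = ℚ.≤-trans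
  (subst (λ z → ∣ z ∣ ≤ (+ 2 / 1) * a⁵ + (a⁵ + δ)) (sym rearrange)
    (∣-∣≤ (corr-taylor-≤ (inv-suc y) (inv-nonNeg (suc (suc y))) b≤a (inv≤1 (suc y))) (unit-block y k)))
  (ℚ.≤-trans (ℚ.≤-reflexive (solve 2 (λ x d → con (+ 2 / 1) :* x :+ (x :+ d) := con (+ 3 / 1) :* x :+ d) refl a⁵ δ))
    (ℚ.+-monoˡ-≤ δ (subst ((+ 3 / 1) * a⁵ ≤_)
      (solve 1 (λ d → con (+ 3 / 1) :* (con (+ 2 / 1) :* d) := con (+ 6 / 1) :* d) refl (fourth (suc y) - fourth (suc (suc y))))
      (ℚ.*-monoˡ-≤-nonNeg (+ 3 / 1) (fifth≤fourths (inv-suc y) (inv-nonNeg (suc (suc y))) b≤a (inv≤1 (suc y)))))))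
  where
  a = inv (suc y)
  b = inv (suc (suc y))
  a⁵ = a * a * a * a * a
  δ = inv (suc k) * (+ 5 / 1)
  b≤a = inv-anti y (suc y) (ℕ.n≤1+n y)
  hk = h (suc y ℕ.* suc k) (suc k)
  rearrange : gap (suc (suc y)) k - gap (suc y) k ≡ ((b - corr b + corr a) - logTaylor a) - (hk - logTaylor a)
  rearrange = trans (cong (λ z → harmonic (suc y) + b - corr b - z - gap (suc y) k) (riemannSum-suc y k))
    (solve 7 (λ H b cb ca r d l → (H :+ b :- cb :- (r :+ d)) :- (H :- ca :- r) := ((b :- cb :+ ca) :- l) :- (d :- l))
      refl (harmonic (suc y)) b (corr b) (corr a) (riemannSum (suc y) k) hk (logTaylor a))

-- The fourth powers telescope, while the mesh errors accumulate to 5ℓ/(k + 1).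
gap-steps : ∀ y ℓ k → ∣ gap (suc y ℕ.+ ℓ) k - gap (suc y) k ∣
          ≤ (+ 6 / 1) * (fourth (suc y) - fourth (suc y ℕ.+ ℓ)) + ι (ℓ ℕ.* 5) * inv (suc k)
gap-steps y zero k = ℚ.≤-reflexive (trans
  (cong (λ z → ∣ gap z k - gap (suc y) k ∣) (ℕ.+-identityʳ (suc y)))
  (trans (a-a (gap (suc y) k)) (sym (trans (cong (λ z → (+ 6 / 1) * (fourth (suc y) - fourth z) + 0ℚ * inv (suc k)) (ℕ.+-identityʳ (suc y)))
    (solve 2 (λ f i → con (+ 6 / 1) :* (f :- f) :+ con 0ℚ :* i := con 0ℚ) refl (fourth (suc y)) (inv (suc k)))))))
gap-steps y (suc ℓ) k = subst (λ x → ∣ gap x k - gap (suc y) k ∣ ≤ (+ 6 / 1) * (fourth (suc y) - fourth x) + ι (suc ℓ ℕ.* 5) * inv (suc k))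
  (sym (ℕ.+-suc (suc y) ℓ))
  (ℚ.≤-trans (tri (gap (suc z) k) (gap z k) (gap (suc y) k))
  (ℚ.≤-trans (ℚ.+-mono-≤ (gap-step (y ℕ.+ ℓ) k) (gap-steps y ℓ k))
    (ℚ.≤-reflexive (trans
      (solve 5 (λ f g h i l → (con (+ 6 / 1) :* (g :- h) :+ i :* con (+ 5 / 1)) :+ (con (+ 6 / 1) :* (f :- g) :+ l :* i)
                 := con (+ 6 / 1) :* (f :- h) :+ (con (+ 5 / 1) :+ l) :* i) refl
        (fourth (suc y)) (fourth z) (fourth (suc z)) (inv (suc k)) (ι (ℓ ℕ.* 5)))
      (cong (λ u → (+ 6 / 1) * (fourth (suc y) - fourth (suc z)) + u * inv (suc k)) (sym (ι-+ 5 (ℓ ℕ.* 5))))))))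
  where
  z = suc y ℕ.+ ℓ

-- For fixed ℓ the mesh error vanishes as k grows; what is left is uniform in ℓ, so ℓ can then tend
-- to infinity.
gap-Small : ∀ y ℓ → Small ((+ 6 / 1) * fourth (suc y)) (λ k → gap (suc y ℕ.+ ℓ) k - gap (suc y) k)
gap-Small y ℓ = Small-≤ (λ k → ι (ℓ ℕ.* 5) * inv (suc k))
  (λ k → ℚ.≤-trans (gap-steps y ℓ k) (ℚ.+-mono-≤
    (0≤-diff {(+ 6 / 1) * (fourth (suc y) - fourth (suc y ℕ.+ ℓ))} ((+ 6 / 1) * fourth (suc y ℕ.+ ℓ)) (0≤* (ℚ.nonNegative⁻¹ (+ 6 / 1)) (0≤fourth (suc y ℕ.+ ℓ)))
      (solve 2 (λ f g → con (+ 6 / 1) :* f := con (+ 6 / 1) :* (f :- g) :+ con (+ 6 / 1) :* g) refl (fourth (suc y)) (fourth (suc y ℕ.+ ℓ))))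
    (p≤∣p∣ (ι (ℓ ℕ.* 5) * inv (suc k)))))
  (Small-inv (ℓ ℕ.* 5))

-- The correction tends to 0, so `gap` and `harmonic-log` share the limit `γ`.
∣corr∣≤ : ∀ n → ∣ corr (inv n) ∣ ≤ inv n
∣corr∣≤ n = ℚ.≤-trans
  (∣-∣≤ (∣*∣≤ (ℚ.≤-refl {∣ ½ ∣}) ∣a∣) (∣*∣≤ (ℚ.≤-refl {∣ ⅟₁₂ ∣}) (∣*∣≤ ∣a∣ (ℚ.≤-trans ∣a∣ (inv≤1 n)))))
  (0≤-diff ((+ 5 / 12) * a) (0≤* (ℚ.nonNegative⁻¹ (+ 5 / 12)) (inv-nonNeg n))
    (solve 1 (λ a → a := con ½ :* a :+ con ⅟₁₂ :* (a :* con 1ℚ) :+ con (+ 5 / 12) :* a) refl a))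
  where
  a = inv n
  ∣a∣ : ∣ a ∣ ≤ a
  ∣a∣ = 0≤p≤c⇒∣p∣≤c (inv-nonNeg n) ℚ.≤-refl

-- H_x = log x + γ + 1/(2x) - 1/(12x²) + O(x⁻⁴)
gap-γ : ∀ y → Small ((+ 6 / 1) * fourth (suc y)) (λ k → gap (suc y) k - seq γ k)
gap-γ y = Small-closed λ ε 0<ε →
  let δ       = ½ * ε
      0<δ     = half-pos 0<ε
      (M , u) = lim-converges harmonic-log harmonic-log-cauchy δ 0<δ
      (N , v) = archimedean δ 0<δ
      -- Far enough that `harmonic-log n` is within δ of `γ` and the correction at n + 1 is at most
      -- δ. The term `harmonic-log n` belongs to `gap (suc n)`.
      ℓ       = M ℕ.+ N
      n       = y ℕ.+ ℓ
      M≤n     = ℕ.≤-trans (ℕ.m≤m+n M N) (ℕ.m≤n+m ℓ y)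
      N≤n     = ℕ.≤-trans (ℕ.m≤n+m N M) (ℕ.m≤n+m ℓ y)
      c       = corr (inv (suc n))
      near : Small (δ + δ) (λ k → (seq (harmonic-log n) k - seq γ k) + (- c))
      near = Small-+ (small {δ} (u n M≤n)) (Small-const (subst (_≤ δ) (sym (ℚ.∣-p∣≡∣p∣ c)) (ℚ.≤-trans (∣corr∣≤ (suc n)) (v n N≤n))))
      -- The factor -1 reverses the difference, so that adding `near` leaves `gap (suc y)` minus
      -- `γ`.
      far : Small ((+ 6 / 1) * fourth (suc y)) (λ k → (- 1ℚ) * (gap (suc n) k - gap (suc y) k))
      far = Small-mono (ℚ.≤-reflexive (ℚ.*-identityˡ ((+ 6 / 1) * fourth (suc y)))) (Small-* (- 1ℚ) ℚ.≤-refl (gap-Small y ℓ))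
  in Small-mono (ℚ.≤-reflexive (cong (_+_ ((+ 6 / 1) * fourth (suc y))) (halves ε)))
       (Small-resp (λ k → solve 5
          (λ H c r g γ → (con (- 1ℚ)) :* (H :- c :- r :- g) :+ ((H :- r :- γ) :+ (:- c)) := g :- γ) refl
          (harmonic (suc n)) c (riemannSum (suc n) k) (gap (suc y) k) (seq γ k))
       (Small-+ far near))

-- For x = y + 1, log (2x) = log x + log 2: the sum over [x , 2x] has the form of a sum over [1 , 2]
-- with each cell cut into x parts, so `refine-dist` applies.
log-double : ∀ y → Small 0ℚ (λ k → riemannSum (suc y ℕ.* 2) k - riemannSum (suc y) k - riemannSum 2 k)
log-double y = Small-≤ (λ k → ι 1 * inv (suc k)) (λ k → subst₂ _≤_ (sym (eq k)) (bound k) (refine-dist k (suc k) y)) (Small-inv 1)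
  where
  bound : ∀ k → inv (suc k) ≡ 0ℚ + ∣ ι 1 * inv (suc k) ∣
  bound k = sym (trans (ℚ.+-identityˡ ∣ ι 1 * inv (suc k) ∣) (trans (cong ∣_∣ (ℚ.*-identityˡ (inv (suc k)))) (ℚ.0≤p⇒∣p∣≡p (inv-nonNeg (suc k)))))
  double : ∀ k → riemannSum (suc y ℕ.* 2) k ≡ riemannSum (suc y) k + h (suc k ℕ.* suc y) (suc k ℕ.* suc y)
  double k = trans (riemannSum≡h (suc y ℕ.* 2) k)
    (trans (cong (h (suc k)) (arith y (suc k)))
    (trans (h-split (suc k) (y ℕ.* suc k) (suc y ℕ.* suc k))
    (cong₂ (λ u v → u + h v v) (sym (riemannSum≡h (suc y) k)) (ℕ.*-comm (suc y) (suc k)))))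
    where
    arith : ∀ y m → suc (y ℕ.* 2) ℕ.* m ≡ y ℕ.* m ℕ.+ suc y ℕ.* m
    arith = ℕ-Tactic.solve-∀
  two : ∀ k → riemannSum 2 k ≡ h (suc k) (suc k)
  two k = trans (riemannSum≡h 2 k) (cong (h (suc k)) (ℕ.*-identityˡ (suc k)))
  eq : ∀ k → ∣ riemannSum (suc y ℕ.* 2) k - riemannSum (suc y) k - riemannSum 2 k ∣
           ≡ ∣ h (suc k) (suc k) - h (suc k ℕ.* suc y) (suc k ℕ.* suc y) ∣
  eq k = trans (cong₂ (λ u v → ∣ u - riemannSum (suc y) k - v ∣) (double k) (two k))
    (trans (cong ∣_∣ (solve 3 (λ r g h → (r :+ g) :- r :- h := g :- h) refl
             (riemannSum (suc y) k) (h (suc k ℕ.* suc y) (suc k ℕ.* suc y)) (h (suc k) (suc k))))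
           (dist-sym (h (suc k ℕ.* suc y) (suc k ℕ.* suc y)) (h (suc k) (suc k))))

-- The error term

powers : ∀ n p q r →
  p * 1/ suc n ^ 1 - q * 1/ suc n ^ 2 + r * 1/ suc n ^ 3
  ≡ p * inv (suc n) - q * (inv (suc n) * inv (suc n)) + r * (inv (suc n) * (inv (suc n) * inv (suc n)))
powers n p q r = cong₂ (λ u v → u + r * v)
  (cong₂ (λ u v → p * u - q * v) (1/^1 n) square)
  (trans (1/^-suc n 2) (cong (inv (suc n) *_) square))
  where
  square : 1/ suc n ^ 2 ≡ inv (suc n) * inv (suc n)
  square = trans (1/^-suc n 1) (cong (inv (suc n) *_) (1/^1 n))

1/^4≡fourth : ∀ n → 1/ suc n ^ 4 ≡ fourth (suc n)
1/^4≡fourth n = trans (1/^-suc n 3) (trans (cong (a *_) (trans (1/^-suc n 2) (cong (a *_) (trans (1/^-suc n 1) (cong (a *_) (1/^1 n))))))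
  (solve 1 (λ a → a :* (a :* (a :* a)) := a :* a :* a :* a) refl a))
  where a = inv (suc n)

inv-half : ∀ m → inv m ≡ (+ 2 / 1) * inv (m ℕ.* 2)
inv-half m = sym (trans (cong ((+ 2 / 1) *_) (inv-* m 2))
  (solve 1 (λ x → con (+ 2 / 1) :* (x :* con ½) := x) refl (inv m)))

fourth-half : ∀ m → fourth m ≡ (+ 16 / 1) * fourth (m ℕ.* 2)
fourth-half m = trans (cong (λ z → z * z * z * z) (inv-half m))
  (solve 1 (λ a → let x = con (+ 2 / 1) :* a in x :* x :* x :* x := con (+ 16 / 1) :* (a :* a :* a :* a)) refl (inv (m ℕ.* 2)))

fourth-suc : ∀ n → fourth (suc (suc n)) ≤ fourth (suc n)
fourth-suc n = *-mono-≤-nonNeg (0≤* (0≤* 0≤b 0≤b) 0≤b) 0≤b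
  (*-mono-≤-nonNeg (0≤* 0≤b 0≤b) 0≤b (*-mono-≤-nonNeg 0≤b 0≤b b≤a b≤a) b≤a) b≤a
  where
  0≤b = inv-nonNeg (suc (suc n))
  b≤a = inv-anti n (suc n) (ℕ.n≤1+n n)

inv-relation : ∀ n → inv (suc n) - inv (suc (suc n)) - inv (suc n) * inv (suc (suc n)) ≡ 0ℚ
inv-relation n = trans (cong (λ z → a - z - a * b) (inv-suc n))
  (solve 2 (λ a b → a :- (a :- a :* b) :- a :* b := con 0ℚ) refl a b)
  where
  a = inv (suc n)
  b = inv (suc (suc n))

∣a³b∣≤ : ∀ n → let a = inv (suc n); b = inv (suc (suc n)) in ∣ a * a * a * b ∣ ≤ fourth (suc n)
∣a³b∣≤ n = ∣*∣≤ (∣*∣≤ (∣*∣≤ ∣a∣ ∣a∣) ∣a∣) (0≤p≤c⇒∣p∣≤c (inv-nonNeg (suc (suc n))) (inv-anti n (suc n) (ℕ.n≤1+n n)))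
  where
  ∣a∣ : ∣ inv (suc n) ∣ ≤ inv (suc n)
  ∣a∣ = 0≤p≤c⇒∣p∣≤c (inv-nonNeg (suc n)) ℚ.≤-refl

∣a²b²∣≤ : ∀ n → let a = inv (suc n); b = inv (suc (suc n)) in ∣ a * a * b * b ∣ ≤ fourth (suc n)
∣a²b²∣≤ n = ∣*∣≤ (∣*∣≤ (∣*∣≤ ∣a∣ ∣a∣) ∣b∣) ∣b∣
  where
  ∣a∣ : ∣ inv (suc n) ∣ ≤ inv (suc n)
  ∣a∣ = 0≤p≤c⇒∣p∣≤c (inv-nonNeg (suc n)) ℚ.≤-refl
  ∣b∣ : ∣ inv (suc (suc n)) ∣ ≤ inv (suc n)
  ∣b∣ = 0≤p≤c⇒∣p∣≤c (inv-nonNeg (suc (suc n))) (inv-anti n (suc n) (ℕ.n≤1+n n))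

-- The parity bit is an argument, so that each case can be proved for a numeral e.
error : (n e : ℕ) .{{_ : ℕ.NonZero n}} → ℝ
error n e = fromℚ (𝔼Z n) -ᴿ
  ( ½ · log n
  +ᴿ ½ · (γ +ᴿ log 2)
  +ᴿ fromℚ ( (+ (1 ℕ.+ e) / 2) * 1/ n ^ 1
           - (+ (2 ℕ.+ 9 ℕ.* e) / 12) * 1/ n ^ 2
           + (+ e / 1) * 1/ n ^ 3 ) )

-- For n = 2m, expand H_n and H_m in H_n + 1/(n + 1) - H_m/2. By `log-double`, log n - (log m)/2
-- becomes (log n + log 2)/2.
error-even : ∀ q → let n = suc q ℕ.* 2 in Small ((+ 55 / 1) * fourth n) (seq (error n 1))
error-even q = Small-mono
  -- 55 = 6 + 6·16/2 + 1, where 16 comes from (n/2)⁻⁴ = 16 n⁻⁴.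
  (0≤-diff 0ℚ ℚ.≤-refl (trans
    (solve 1 (λ f → con (+ 55 / 1) :* f := con (+ 6 / 1) :* f :+ con ½ :* (con (+ 6 / 1) :* (con (+ 16 / 1) :* f)) :+ con ½ :* con 0ℚ :+ f :+ con 0ℚ) refl (fourth n))
    (cong (λ z → (+ 6 / 1) * fourth n + ½ * ((+ 6 / 1) * z) + ½ * 0ℚ + fourth n + 0ℚ) (sym (fourth-half m)))))
  (Small-resp eq
    (Small-+ (Small-+ (Small-+ (gap-γ n′) (Small-* (- ½) ½≤1 (gap-γ q))) (Small-* ½ ½≤1 (log-double q)))
             (Small-const remainder)))
  where
  m = suc q
  n = m ℕ.* 2
  n′ = suc (q ℕ.* 2)
  a = inv n
  b = inv (suc n)
  ½≤1 : ½ ≤ 1ℚ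
  ½≤1 = 0≤-diff ½ (ℚ.nonNegative⁻¹ ½) refl
  poly = 1ℚ * a - (+ 11 / 12) * (a * a) + 1ℚ * (a * (a * a))
  -- The part of the error independent of k; modulo a - b - a b it is - a³ b.
  const = corr a - ½ * corr (inv m) + b - poly
  remainder : ∣ const ∣ ≤ fourth n
  remainder = subst (λ z → ∣ z ∣ ≤ fourth n)
    (sym (trans (cong (λ z → corr a - ½ * corr z + b - poly) (inv-half m))
      (modulo (- (a * a) + a - 1ℚ) (inv-relation n′) (solve 2 (λ a b →
        let cr = λ x → con ½ :* x :- con ⅟₁₂ :* (x :* x)
        in cr a :- con ½ :* cr (con (+ 2 / 1) :* a) :+ b
           :- (con 1ℚ :* a :- con (+ 11 / 12) :* (a :* a) :+ con 1ℚ :* (a :* (a :* a)))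
           := :- (a :* a :* a :* b) :+ (:- (a :* a) :+ a :- con 1ℚ) :* (a :- b :- a :* b)) refl a b))))
    (subst (_≤ fourth n) (sym (ℚ.∣-p∣≡∣p∣ (a * a * a * b))) (∣a³b∣≤ n′))
  eq : ∀ k → (gap n k - seq γ k) + (- ½) * (gap m k - seq γ k) + ½ * (riemannSum n k - riemannSum m k - riemannSum 2 k) + const
           ≡ seq (error n 1) k
  eq k = trans
    (solve 10 (λ Hn Hm cn cm rn rm r2 γ b p →
      (Hn :- cn :- rn :- γ) :+ con (- ½) :* (Hm :- cm :- rm :- γ) :+ con ½ :* (rn :- rm :- r2)
      :+ (cn :- con ½ :* cm :+ b :- p)
      := (Hn :+ b :- con ½ :* Hm) :- (con ½ :* rn :+ con ½ :* (γ :+ r2) :+ p)) refl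
      (harmonic n) (harmonic m) (corr a) (corr (inv m)) (riemannSum n k) (riemannSum m k) (riemannSum 2 k) (seq γ k) b poly)
    (cong₂ (λ u v → u - (½ * riemannSum n k + ½ * (seq γ k + riemannSum 2 k) + v))
      (sym (𝔼Z-even m)) (sym (powers n′ 1ℚ (+ 11 / 12) 1ℚ)))

-- H_n is taken as the mean of two readings, directly and as H_{n+1} - 1/(n + 1). This gives log (n
-- + 1) the weight 1/2, and half of `log-double` at n + 1 = 2m cancels it together with log m.
error-odd : ∀ q → let n = suc (q ℕ.* 2) in Small ((+ 55 / 1) * fourth n) (seq (error n 0))
error-odd q = Small-mono
  -- After (n + 1)⁻⁴ ≤ n⁻⁴ the constant is 55 = (6 + 6 + 6·16)/2 + 1.
  (ℚ.≤-trans
    (ℚ.+-monoˡ-≤ (fourth n) (ℚ.*-monoˡ-≤-nonNeg ½ (ℚ.+-monoˡ-≤ 0ℚ (ℚ.+-mono-≤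
      (ℚ.+-monoʳ-≤ ((+ 6 / 1) * fourth n) (ℚ.*-monoˡ-≤-nonNeg (+ 6 / 1) (fourth-suc (q ℕ.* 2))))
      (ℚ.*-monoˡ-≤-nonNeg 1ℚ (ℚ.*-monoˡ-≤-nonNeg (+ 6 / 1) (subst (_≤ (+ 16 / 1) * fourth n) (sym (fourth-half m))
        (ℚ.*-monoˡ-≤-nonNeg (+ 16 / 1) (fourth-suc (q ℕ.* 2))))))))))
    (ℚ.≤-reflexive (solve 1 (λ f → con ½ :* ((con (+ 6 / 1) :* f :+ con (+ 6 / 1) :* f) :+ con 1ℚ :* (con (+ 6 / 1) :* (con (+ 16 / 1) :* f)) :+ con 0ℚ) :+ f
      := con (+ 55 / 1) :* f) refl (fourth n))))
  (Small-resp eq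
    (Small-+ (Small-* ½ ½≤1 (Small-+ (Small-+ (Small-+ (gap-γ (q ℕ.* 2)) (gap-γ n)) (Small-* (- 1ℚ) ℚ.≤-refl (gap-γ q))) (log-double q)))
             (Small-const remainder)))
  where
  m = suc q
  n = suc (q ℕ.* 2)
  N = m ℕ.* 2
  a = inv n
  b = inv N
  ½≤1 : ½ ≤ 1ℚ
  ½≤1 = 0≤-diff ½ (ℚ.nonNegative⁻¹ ½) refl
  poly = ½ * a - (+ 2 / 12) * (a * a) + 0ℚ * (a * (a * a))
  -- Modulo a - b - a b this is a² b²/8.
  const = ½ * (b + corr a + corr b - corr (inv m)) - poly
  remainder : ∣ const ∣ ≤ fourth n
  remainder = subst (λ z → ∣ z ∣ ≤ fourth n)
    (sym (trans (cong (λ z → ½ * (b + corr a + corr b - corr z) - poly) (inv-half m))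
      (modulo ((+ 1 / 8) * (a * b + a - b) - ¼) (inv-relation (q ℕ.* 2)) (solve 2 (λ a b →
        let cr = λ x → con ½ :* x :- con ⅟₁₂ :* (x :* x)
        in con ½ :* (b :+ cr a :+ cr b :- cr (con (+ 2 / 1) :* b))
           :- (con ½ :* a :- con (+ 2 / 12) :* (a :* a) :+ con 0ℚ :* (a :* (a :* a)))
           := con (+ 1 / 8) :* (a :* a :* b :* b) :+ (con (+ 1 / 8) :* (a :* b :+ a :- b) :- con ¼) :* (a :- b :- a :* b)) refl a b))))
    (ℚ.≤-trans (∣*∣≤ (0≤-diff {∣ + 1 / 8 ∣} {1ℚ} (+ 7 / 8) (ℚ.nonNegative⁻¹ (+ 7 / 8)) refl) (∣a²b²∣≤ (q ℕ.* 2)))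
               (ℚ.≤-reflexive (ℚ.*-identityˡ (fourth n))))
  eq : ∀ k → ½ * ((gap n k - seq γ k) + (gap N k - seq γ k) + (- 1ℚ) * (gap m k - seq γ k) + (riemannSum N k - riemannSum m k - riemannSum 2 k)) + const
           ≡ seq (error n 0) k
  eq k = trans
    (solve 13 (λ Hn Hq im cn cN cm rn rN rm r2 γ b p →
      con ½ :* ((Hn :- cn :- rn :- γ) :+ (Hn :+ b :- cN :- rN :- γ) :+ con (- 1ℚ) :* (Hq :+ im :- cm :- rm :- γ) :+ (rN :- rm :- r2))
      :+ (con ½ :* (b :+ cn :+ cN :- cm) :- p)
      := (Hn :- con ½ :* Hq :+ (b :- con ½ :* im)) :- (con ½ :* rn :+ con ½ :* (γ :+ r2) :+ p)) refl
      (harmonic n) (harmonic q) (inv m) (corr a) (corr b) (corr (inv m)) (riemannSum n k) (riemannSum N k) (riemannSum m k)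
      (riemannSum 2 k) (seq γ k) b poly)
    (cong₂ (λ u v → u - (½ * riemannSum n k + ½ * (seq γ k + riemannSum 2 k) + v))
      (trans (cong (λ z → harmonic n - ½ * harmonic q + (b - ½ * z)) (inv-half m))
      (trans (solve 2 (λ x b → x :+ (b :- con ½ :* (con (+ 2 / 1) :* b)) := x) refl (harmonic n - ½ * harmonic q) b)
        (sym (trans (𝔼Z-odd q) (𝔼Z-even q)))))
      (sym (powers (q ℕ.* 2) ½ (+ 2 / 12) 0ℚ)))

even⊎odd : ∀ n → (∃[ q ] n ≡ q ℕ.* 2) ⊎ (∃[ q ] n ≡ suc (q ℕ.* 2))
even⊎odd zero    = inj₁ (0 , refl)
even⊎odd (suc n) with even⊎odd n
... | inj₁ (q , e) = inj₂ (q , cong suc e)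
... | inj₂ (q , e) = inj₁ (suc q , cong suc e)

corollaryD2 : ∃ λ (C : ℚ) → ∃ λ (N : ℕ) →
    ∀ (n : ℕ) .{{_ : ℕ.NonZero n}} → N ℕ.≤ n →
    let e = [ even? n ] in
    ∣ fromℚ (𝔼Z n) -ᴿ
    ( ½ · log n
    +ᴿ ½ · (γ +ᴿ log 2)
    +ᴿ fromℚ ( (+ (1 ℕ.+ e) / 2) * 1/ n ^ 1
    - (+ (2 ℕ.+ 9 ℕ.* e) / 12) * 1/ n ^ 2
    + (+ e / 1) * 1/ n ^ 3 ) ) ∣ᴿ
    ≤ᴿ fromℚ (C * 1/ n ^ 4)
-- Both parities give the constant 55, and for every positive n.
corollaryD2 = + 55 / 1 , 0 , λ n _ → bound n (even⊎odd n)
  where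
  Bound : (n e : ℕ) .{{_ : ℕ.NonZero n}} → Set
  Bound n e = ∣ error n e ∣ᴿ ≤ᴿ fromℚ ((+ 55 / 1) * 1/ n ^ 4)
  to-Bound : ∀ n e → Small ((+ 55 / 1) * fourth (suc n)) (seq (error (suc n) e)) → Bound (suc n) e
  to-Bound n e s = Small.eventually (Small-mono (ℚ.≤-reflexive (cong (_*_ (+ 55 / 1)) (sym (1/^4≡fourth n)))) s)
  bound : ∀ n .{{_ : ℕ.NonZero n}} → (∃[ q ] n ≡ q ℕ.* 2) ⊎ (∃[ q ] n ≡ suc (q ℕ.* 2)) → Bound n [ even? n ]
  -- Here n = 0, which contradicts the irrelevant instance `nz`.
  bound _ {{nz}} (inj₁ (zero  , refl)) = ⊥-elim (ℕ.NonZero.nonZero nz)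
  bound _ (inj₁ (suc q , refl)) = subst (λ e → Bound (suc q ℕ.* 2) e)
    (sym ([]-true (even? (suc q ℕ.* 2)) (divides (suc q) refl)))
    (to-Bound (suc (q ℕ.* 2)) 1 (error-even q))
  bound _ (inj₂ (q , refl)) = subst (λ e → Bound (suc (q ℕ.* 2)) e)
    (sym ([]-false (even? (suc (q ℕ.* 2))) λ { (divides j e) → odd≢even q j (sym e) }))
    (to-Bound (q ℕ.* 2) 0 (error-odd q))
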